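{- Let $k\ge 1$ be an integer. Then: (1) $f(P_3^k)=2$; (2) $f(P_m^k)=1$ for every odd integer $m=2n+1\ge 5$; (3) $f(P_m^k)\ge \lceil \sqrt{\beta_n k}\,\rceil$ for every even integer $m=2n\ge 2$, where $\beta_n>0$ is the constant depending only on $n$ given by the minimum positive root of the polynomial $g_n(x)$. In particular, $\beta_1=1$.
   Context: All graphs are simple and finite. For a graph $G$, $\alpha(G)$ is its independence number, $\Delta(G)$ its maximum degree, and $G[S]$ the subgraph induced by $S\subseteq V(G)$. Define $$f(G)=\min\{\Delta(G[S]) : S\subseteq V(G),\ |S|=\alpha(G)+1\}.$$ $P_m$ is the path on $m$ vertices, and $P_m^k=P_m\square\cdots\square P_m$ is the Cartesian product of $k$ copies of $P_m$ (vertices of $G\square H$ are pairs; $(x_1,x_2)$ and $(y_1,y_2)$ are adjacent iff $x_1=y_1$ and $x_2y_2\in E(H)$, or $x_2=y_2$ and $x_1y_1\in E(G)$). The polynomials $g_n$ are defined by $g_0(x)=1$, $g_1(x)=x-1$, and $g_j(x)=(x-2)g_{j-1}(x)-g_{j-2}(x)$ for $j\ge 2$; $\beta_n$ ($n\ge 1$) denotes the minimum positive root of $g_n(x)$. -}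

module Defs where

open import Data.Nat.Base as ℕ using (ℕ; zero; suc)
open import Data.Nat.Properties as ℕₚ using ()
open import Data.Integer.Base as ℤ using (ℤ; +_)
open import Data.Rational.Base as ℚ
  using (ℚ; 0ℚ; 1ℚ; ½; _+_; _*_; _-_; -_; ∣_∣; _<_; 1/_)
open import Data.Rational.Properties as ℚₚ using ()
open import Algebra.Bundles using (CommutativeMonoid)
open import Algebra.Properties.CommutativeSemigroup
  (CommutativeMonoid.commutativeSemigroup ℚₚ.+-0-commutativeMonoid)
  using (interchange)
open import Data.Fin.Base using (Fin; zero; suc; toℕ; remQuot)
open import Data.Fin.Properties as Finₚ using (all?)
open import Data.Fin.Subset as Subset using (Subset; inside; outside; _∈_)
open import Data.Fin.Subset.Properties using (_∈?_)
open import Data.List.Base using (List; []; _∷_; _++_; map; filter)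
open import Data.List.Extrema.Nat using (max; min)
import Data.List.Base as List
open import Data.Vec.Base as Vec using ([]; _∷_)
open import Data.Product.Base using (_×_; _,_; proj₁; proj₂; ∃-syntax)
open import Data.Sum.Base using (_⊎_; inj₁; inj₂)
open import Data.Empty using (⊥)
open import Function.Base using (_∘_)
open import Relation.Nullary.Negation using (¬_)
open import Relation.Nullary.Decidable
  using (Dec; no; does; ¬?; _×-dec_; _⊎-dec_; _→-dec_)
open import Relation.Binary.PropositionalEquality
  using (_≡_; refl; sym; trans; cong; cong₂; subst)

-- Finite simple graphs, with the vertices labelled by Fin n.
record Graph (n : ℕ) : Set₁ where
  field
    Adj        : Fin n → Fin n → Set
    adj?       : ∀ u v → Dec (Adj u v)
    adj-sym    : ∀ {u v} → Adj u v → Adj v u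
    adj-irrefl : ∀ {u} → ¬ Adj u u

open Graph public

neighbours : ∀ {n} → Graph n → Fin n → Subset n
neighbours G u = Vec.tabulate (λ v → does (adj? G u v))

degree : ∀ {n} → Graph n → Fin n → ℕ
degree G u = Subset.∣ neighbours G u ∣

-- Maximum degree, with Δ = 0 for the graph without vertices.
Δ : ∀ {n} → Graph n → ℕ
Δ {n} G = max 0 (map (degree G) (List.allFin n))

-- The increasing enumeration of the elements of S.
element : ∀ {n} (S : Subset n) → Fin Subset.∣ S ∣ → Fin n
element (inside  ∷ S) zero    = zero
element (inside  ∷ S) (suc i) = suc (element S i)
element (outside ∷ S) i       = suc (element S i)

_[_] : ∀ {n} → Graph n → (S : Subset n) → Graph Subset.∣ S ∣
G [ S ] = record
  { Adj        = λ i j → Adj G (element S i) (element S j)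
  ; adj?       = λ i j → adj? G (element S i) (element S j)
  ; adj-sym    = adj-sym G
  ; adj-irrefl = adj-irrefl G
  }

subsets : ∀ n → List (Subset n)
subsets zero    = [] ∷ []
subsets (suc n) = map (inside ∷_) (subsets n) ++ map (outside ∷_) (subsets n)

Independent : ∀ {n} → Graph n → Subset n → Set
Independent G S = ∀ u v → u ∈ S → v ∈ S → ¬ Adj G u v

independent? : ∀ {n} (G : Graph n) (S : Subset n) → Dec (Independent G S)
independent? G S = all? λ u → all? λ v →
  (u ∈? S) →-dec ((v ∈? S) →-dec ¬? (adj? G u v))

α : ∀ {n} → Graph n → ℕ
α {n} G = max 0 (map Subset.∣_∣ (filter (independent? G) (subsets n)))

-- The first argument of min is the value at the empty list.  Since every
-- Δ (G [ S ]) is at most n, it only matters when no set of size α(G) + 1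
-- exists, that is, when G has no edges.
f : ∀ {n} → Graph n → ℕ
f {n} G = min n (map (λ S → Δ (G [ S ]))
                     (filter (λ S → Subset.∣ S ∣ ℕₚ.≟ suc (α G)) (subsets n)))

Path : ∀ m → Graph m
Path m = record
  { Adj        = λ i j → toℕ j ≡ suc (toℕ i) ⊎ toℕ i ≡ suc (toℕ j)
  ; adj?       = λ i j → (toℕ j ℕₚ.≟ suc (toℕ i)) ⊎-dec (toℕ i ℕₚ.≟ suc (toℕ j))
  ; adj-sym    = λ { (inj₁ e) → inj₂ e ; (inj₂ e) → inj₁ e }
  ; adj-irrefl = λ { (inj₁ e) → ℕₚ.1+n≢n (sym e) ; (inj₂ e) → ℕₚ.1+n≢n (sym e) }
  }

-- A vertex u : Fin (m * n) encodes the pair remQuot n u : Fin m × Fin n.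
_□_ : ∀ {m n} → Graph m → Graph n → Graph (m ℕ.* n)
_□_ {m} {n} G H = record
  { Adj        = λ u v → Adj□ (remQuot n u) (remQuot n v)
  ; adj?       = λ u v → adj□? (remQuot n u) (remQuot n v)
  ; adj-sym    = λ { (inj₁ (e , a)) → inj₁ (sym e , adj-sym H a)
                   ; (inj₂ (e , a)) → inj₂ (sym e , adj-sym G a) }
  ; adj-irrefl = λ { (inj₁ (_ , a)) → adj-irrefl H a
                   ; (inj₂ (_ , a)) → adj-irrefl G a }
  }
  where
  Adj□ : Fin m × Fin n → Fin m × Fin n → Set
  Adj□ (x₁ , x₂) (y₁ , y₂) =
    (x₁ ≡ y₁ × Adj H x₂ y₂) ⊎ (x₂ ≡ y₂ × Adj G x₁ y₁)

  adj□? : ∀ x y → Dec (Adj□ x y)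
  adj□? (x₁ , x₂) (y₁ , y₂) =
    ((x₁ Finₚ.≟ y₁) ×-dec adj? H x₂ y₂) ⊎-dec ((x₂ Finₚ.≟ y₂) ×-dec adj? G x₁ y₁)

K₁ : Graph 1
K₁ = record
  { Adj        = λ _ _ → ⊥
  ; adj?       = λ _ _ → no λ ()
  ; adj-sym    = λ ()
  ; adj-irrefl = λ ()
  }

-- The empty product is K₁, the unit of □ up to isomorphism.
_^□_ : ∀ {m} → Graph m → (k : ℕ) → Graph (m ℕ.^ k)
G ^□ zero  = K₁
G ^□ suc k = G □ (G ^□ k)

infixr 7 _□_
infixl 8 _^□_

-- Real numbers are Cauchy sequences of rationals up to _≃_.

IsCauchy : (ℕ → ℚ) → Set
IsCauchy x = ∀ ε → 0ℚ < ε →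
  ∃[ N ] ∀ i j → N ℕ.≤ i → N ℕ.≤ j → ∣ x i - x j ∣ < ε

record ℝ : Set where
  constructor mkℝ
  field
    seq    : ℕ → ℚ
    cauchy : IsCauchy seq

open ℝ public

infix 4 _≃_ _<ᴿ_ _≤ᴿ_

_≃_ : ℝ → ℝ → Set
x ≃ y = ∀ ε → 0ℚ < ε → ∃[ N ] ∀ i → N ℕ.≤ i → ∣ seq x i - seq y i ∣ < ε

_<ᴿ_ : ℝ → ℝ → Set
x <ᴿ y = ∃[ ε ] (0ℚ < ε × ∃[ N ] ∀ i → N ℕ.≤ i → seq x i + ε < seq y i)

_≤ᴿ_ : ℝ → ℝ → Set
x ≤ᴿ y = ¬ (y <ᴿ x)

abstract
  half-pos : ∀ {ε} → 0ℚ < ε → 0ℚ < ½ * ε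
  half-pos {ε} 0<ε = subst (_< ½ * ε) (ℚₚ.*-zeroʳ ½) (ℚₚ.*-monoʳ-<-pos ½ 0<ε)

  halves : ∀ ε → ½ * ε + ½ * ε ≡ ε
  halves ε = trans (sym (ℚₚ.*-distribʳ-+ ε ½ ½)) (ℚₚ.*-identityˡ ε)

  const-cauchy : ∀ q → IsCauchy (λ _ → q)
  const-cauchy q ε 0<ε =
    0 , λ _ _ _ _ → subst (_< ε) (cong ∣_∣ (sym (ℚₚ.+-inverseʳ q))) 0<ε

  neg-cauchy : ∀ {x} → IsCauchy x → IsCauchy (λ i → - x i)
  neg-cauchy {x} cx ε 0<ε = proj₁ (cx ε 0<ε) , λ i j N≤i N≤j →
    subst (_< ε) (trans (sym (ℚₚ.∣-p∣≡∣p∣ (x i - x j)))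
                        (cong ∣_∣ (ℚₚ.neg-distrib-+ (x i) (- x j))))
          (proj₂ (cx ε 0<ε) i j N≤i N≤j)

  +-cauchy : ∀ {x y} → IsCauchy x → IsCauchy y → IsCauchy (λ i → x i + y i)
  +-cauchy {x} {y} cx cy ε 0<ε = M ℕ.⊔ N , λ i j h h′ → begin-strict
      ∣ (x i + y i) - (x j + y j) ∣
    ≡⟨ cong ∣_∣ (rearrange (x i) (y i) (x j) (y j)) ⟩
      ∣ (x i - x j) + (y i - y j) ∣
    ≤⟨ ℚₚ.∣p+q∣≤∣p∣+∣q∣ (x i - x j) (y i - y j) ⟩
      ∣ x i - x j ∣ + ∣ y i - y j ∣
    <⟨ ℚₚ.+-mono-<
         (proj₂ X i j (ℕₚ.m⊔n≤o⇒m≤o M N h) (ℕₚ.m⊔n≤o⇒m≤o M N h′))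
         (proj₂ Y i j (ℕₚ.m⊔n≤o⇒n≤o M N h) (ℕₚ.m⊔n≤o⇒n≤o M N h′)) ⟩
      ½ * ε + ½ * ε
    ≡⟨ halves ε ⟩
      ε ∎
    where
    open ℚₚ.≤-Reasoning
    X : ∃[ M ] ∀ i j → M ℕ.≤ i → M ℕ.≤ j → ∣ x i - x j ∣ < ½ * ε
    X = cx (½ * ε) (half-pos 0<ε)
    Y : ∃[ N ] ∀ i j → N ℕ.≤ i → N ℕ.≤ j → ∣ y i - y j ∣ < ½ * ε
    Y = cy (½ * ε) (half-pos 0<ε)
    M N : ℕ
    M = proj₁ X
    N = proj₁ Y
    rearrange : ∀ a b c d → (a + b) - (c + d) ≡ (a - c) + (b - d)
    rearrange a b c d = trans (cong (_+_ (a + b)) (ℚₚ.neg-distrib-+ c d))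
                              (interchange a b (- c) (- d))

  minus-plus : ∀ p q → (p - q) + q ≡ p
  minus-plus p q = trans (ℚₚ.+-assoc p (- q) q)
    (trans (cong (_+_ p) (ℚₚ.+-inverseˡ q)) (ℚₚ.+-identityʳ p))

  eventually-bounded : ∀ {x} → IsCauchy x →
    ∃[ B ] (0ℚ < B × ∃[ N ] ∀ i → N ℕ.≤ i → ∣ x i ∣ ℚ.≤ B)
  eventually-bounded {x} cx = B , 0<B , N , bound
    where
    open ℚₚ.≤-Reasoning
    0<1 : 0ℚ < 1ℚ
    0<1 = ℚₚ.positive⁻¹ 1ℚ
    N : ℕ
    N = proj₁ (cx 1ℚ 0<1)
    B : ℚ
    B = 1ℚ + ∣ x N ∣
    0<B : 0ℚ < B
    0<B = ℚₚ.+-mono-<-≤ 0<1 (ℚₚ.0≤∣p∣ (x N))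
    bound : ∀ i → N ℕ.≤ i → ∣ x i ∣ ℚ.≤ B
    bound i N≤i = begin
      ∣ x i ∣                   ≡⟨ cong ∣_∣ (sym (minus-plus (x i) (x N))) ⟩
      ∣ (x i - x N) + x N ∣     ≤⟨ ℚₚ.∣p+q∣≤∣p∣+∣q∣ (x i - x N) (x N) ⟩
      ∣ x i - x N ∣ + ∣ x N ∣   ≤⟨ ℚₚ.+-monoˡ-≤ ∣ x N ∣ (ℚₚ.<⇒≤
                                    (proj₂ (cx 1ℚ 0<1) i N N≤i ℕₚ.≤-refl)) ⟩
      B                         ∎

  scaled : ∀ {ε B} → 0ℚ < ε → 0ℚ < B → ∃[ δ ] (0ℚ < δ × B * δ ≡ ε)
  scaled {ε} {B} 0<ε 0<B = (1/ B) * ε , 0<δ , eq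
    where
    instance
      posB : ℚ.Positive B
      posB = ℚ.positive 0<B
      nzB : ℚ.NonZero B
      nzB = ℚₚ.pos⇒nonZero B
      pos1/B : ℚ.Positive (1/ B)
      pos1/B = ℚₚ.1/pos⇒pos B
    0<δ : 0ℚ < (1/ B) * ε
    0<δ = subst (_< (1/ B) * ε) (ℚₚ.*-zeroʳ (1/ B)) (ℚₚ.*-monoʳ-<-pos (1/ B) 0<ε)
    eq : B * ((1/ B) * ε) ≡ ε
    eq = trans (sym (ℚₚ.*-assoc B (1/ B) ε))
               (trans (cong (_* ε) (ℚₚ.*-inverseʳ B)) (ℚₚ.*-identityˡ ε))

  mul-bound : ∀ {a b B δ} → 0ℚ < B → ∣ a ∣ ℚ.≤ B → ∣ b ∣ < δ → ∣ a * b ∣ < B * δ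
  mul-bound {a} {b} {B} {δ} 0<B a≤B b<δ = begin-strict
    ∣ a * b ∣       ≡⟨ ℚₚ.∣p*q∣≡∣p∣*∣q∣ a b ⟩
    ∣ a ∣ * ∣ b ∣   ≤⟨ ℚₚ.*-monoʳ-≤-nonNeg ∣ b ∣ {{ℚₚ.∣-∣-nonNeg b}} a≤B ⟩
    B * ∣ b ∣       <⟨ ℚₚ.*-monoʳ-<-pos B {{ℚ.positive 0<B}} b<δ ⟩
    B * δ           ∎
    where open ℚₚ.≤-Reasoning

  telescope : ∀ p q r → (p - q) + (q - r) ≡ p - r
  telescope p q r = trans (sym (ℚₚ.+-assoc (p - q) q (- r)))
                          (cong (_+ - r) (minus-plus p q))

  *-minus : ∀ p q r → p * (q - r) ≡ p * q - p * r
  *-minus p q r = trans (ℚₚ.*-distribˡ-+ p q (- r))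
                        (cong (_+_ (p * q)) (sym (ℚₚ.neg-distribʳ-* p r)))

  rearrange-* : ∀ a b c d → a * (b - d) + d * (a - c) ≡ a * b - c * d
  rearrange-* a b c d = trans
    (cong₂ _+_ (*-minus a b d)
      (trans (*-minus d a c) (cong₂ _-_ (ℚₚ.*-comm d a) (ℚₚ.*-comm d c))))
    (telescope (a * b) (a * d) (c * d))

  *-cauchy : ∀ {x y} → IsCauchy x → IsCauchy y → IsCauchy (λ i → x i * y i)
  *-cauchy {x} {y} cx cy ε 0<ε =
    let B , 0<B , N₁ , x≤B = eventually-bounded {x} cx
        C , 0<C , N₂ , y≤C = eventually-bounded {y} cy
        δ , 0<δ , Bδ       = scaled (half-pos 0<ε) 0<B
        η , 0<η , Cη       = scaled (half-pos 0<ε) 0<C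
        N₃ , hy            = cy δ 0<δ
        N₄ , hx            = cx η 0<η
    in step B 0<B N₁ x≤B C 0<C N₂ y≤C δ Bδ η Cη N₃ hy N₄ hx
    where
    open ℚₚ.≤-Reasoning
    step : ∀ B → 0ℚ < B → ∀ N₁ → (∀ i → N₁ ℕ.≤ i → ∣ x i ∣ ℚ.≤ B) →
           ∀ C → 0ℚ < C → ∀ N₂ → (∀ i → N₂ ℕ.≤ i → ∣ y i ∣ ℚ.≤ C) →
           ∀ δ → B * δ ≡ ½ * ε → ∀ η → C * η ≡ ½ * ε →
           ∀ N₃ → (∀ i j → N₃ ℕ.≤ i → N₃ ℕ.≤ j → ∣ y i - y j ∣ < δ) →
           ∀ N₄ → (∀ i j → N₄ ℕ.≤ i → N₄ ℕ.≤ j → ∣ x i - x j ∣ < η) →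
           ∃[ N ] ∀ i j → N ℕ.≤ i → N ℕ.≤ j → ∣ x i * y i - x j * y j ∣ < ε
    step B 0<B N₁ x≤B C 0<C N₂ y≤C δ Bδ η Cη N₃ hy N₄ hx =
      (N₁ ℕ.⊔ N₂) ℕ.⊔ (N₃ ℕ.⊔ N₄) , λ i j h h′ → begin-strict
        ∣ x i * y i - x j * y j ∣
      ≡⟨ cong ∣_∣ (sym (rearrange-* (x i) (y i) (x j) (y j))) ⟩
        ∣ x i * (y i - y j) + y j * (x i - x j) ∣
      ≤⟨ ℚₚ.∣p+q∣≤∣p∣+∣q∣ (x i * (y i - y j)) (y j * (x i - x j)) ⟩
        ∣ x i * (y i - y j) ∣ + ∣ y j * (x i - x j) ∣
      <⟨ ℚₚ.+-mono-<
           (mul-bound {x i} {y i - y j} 0<B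
             (x≤B i (ge₁ h)) (hy i j (ge₃ h) (ge₃ h′)))
           (mul-bound {y j} {x i - x j} 0<C
             (y≤C j (ge₂ h′)) (hx i j (ge₄ h) (ge₄ h′))) ⟩
        B * δ + C * η
      ≡⟨ cong₂ _+_ Bδ Cη ⟩
        ½ * ε + ½ * ε
      ≡⟨ halves ε ⟩
        ε ∎
      where
      ge₁₂ : ∀ {i} → (N₁ ℕ.⊔ N₂) ℕ.⊔ (N₃ ℕ.⊔ N₄) ℕ.≤ i → N₁ ℕ.⊔ N₂ ℕ.≤ i
      ge₁₂ = ℕₚ.m⊔n≤o⇒m≤o (N₁ ℕ.⊔ N₂) (N₃ ℕ.⊔ N₄)
      ge₃₄ : ∀ {i} → (N₁ ℕ.⊔ N₂) ℕ.⊔ (N₃ ℕ.⊔ N₄) ℕ.≤ i → N₃ ℕ.⊔ N₄ ℕ.≤ i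
      ge₃₄ = ℕₚ.m⊔n≤o⇒n≤o (N₁ ℕ.⊔ N₂) (N₃ ℕ.⊔ N₄)
      ge₁ : ∀ {i} → (N₁ ℕ.⊔ N₂) ℕ.⊔ (N₃ ℕ.⊔ N₄) ℕ.≤ i → N₁ ℕ.≤ i
      ge₁ = ℕₚ.m⊔n≤o⇒m≤o N₁ N₂ ∘ ge₁₂
      ge₂ : ∀ {i} → (N₁ ℕ.⊔ N₂) ℕ.⊔ (N₃ ℕ.⊔ N₄) ℕ.≤ i → N₂ ℕ.≤ i
      ge₂ = ℕₚ.m⊔n≤o⇒n≤o N₁ N₂ ∘ ge₁₂
      ge₃ : ∀ {i} → (N₁ ℕ.⊔ N₂) ℕ.⊔ (N₃ ℕ.⊔ N₄) ℕ.≤ i → N₃ ℕ.≤ i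
      ge₃ = ℕₚ.m⊔n≤o⇒m≤o N₃ N₄ ∘ ge₃₄
      ge₄ : ∀ {i} → (N₁ ℕ.⊔ N₂) ℕ.⊔ (N₃ ℕ.⊔ N₄) ℕ.≤ i → N₄ ℕ.≤ i
      ge₄ = ℕₚ.m⊔n≤o⇒n≤o N₃ N₄ ∘ ge₃₄

infixl 6 _+ᴿ_ _-ᴿ_
infixl 7 _*ᴿ_

_+ᴿ_ : ℝ → ℝ → ℝ
mkℝ x cx +ᴿ mkℝ y cy = mkℝ (λ i → x i + y i) (+-cauchy {x} {y} cx cy)

-ᴿ_ : ℝ → ℝ
-ᴿ mkℝ x cx = mkℝ (λ i → - x i) (neg-cauchy {x} cx)

_-ᴿ_ : ℝ → ℝ → ℝ
x -ᴿ y = x +ᴿ (-ᴿ y)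

_*ᴿ_ : ℝ → ℝ → ℝ
mkℝ x cx *ᴿ mkℝ y cy = mkℝ (λ i → x i * y i) (*-cauchy {x} {y} cx cy)

fromℤ : ℤ → ℝ
fromℤ z = mkℝ (λ _ → z ℚ./ 1) (const-cauchy (z ℚ./ 1))

0ᴿ 1ᴿ 2ᴿ : ℝ
0ᴿ = fromℤ (+ 0)
1ᴿ = fromℤ (+ 1)
2ᴿ = fromℤ (+ 2)

IsSqrt : ℝ → ℝ → Set
IsSqrt x r = 0ᴿ ≤ᴿ r × r *ᴿ r ≃ x

-- A relation, since the ceiling is not a computable function on ℝ.
IsCeiling : ℝ → ℤ → Set
IsCeiling r c = r ≤ᴿ fromℤ c × (∀ d → r ≤ᴿ fromℤ d → c ℤ.≤ d)

g : ℕ → ℝ → ℝ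
g 0             x = 1ᴿ
g 1             x = x -ᴿ 1ᴿ
g (suc (suc j)) x = (x -ᴿ 2ᴿ) *ᴿ g (suc j) x -ᴿ g j x

IsPositiveRoot : (ℝ → ℝ) → ℝ → Set
IsPositiveRoot p x = 0ᴿ <ᴿ x × p x ≃ 0ᴿ

IsMinPositiveRoot : (ℝ → ℝ) → ℝ → Set
IsMinPositiveRoot p x =
  IsPositiveRoot p x × (∀ y → IsPositiveRoot p y → x ≤ᴿ y)

{-# OPTIONS --safe #-}
module Submission where

-- Lower bounds.  The edges of the k-fold product can be signed so that the
-- square of the adjacency matrix A becomes the sum of the squares of the path
-- matrices acting on the k coordinates.  If S has more vertices than a class X
-- of the proper 2-colouring, in particular if |S| = α + 1, counting dimensions
-- gives a vector y ≠ 0 that is supported on S, vanishes on X, and has A y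
-- supported on S.  Then |A y| ≤ d |y| for the maximum degree d of S, whereas
-- |A y|² is at least k βₙ |y|² for paths on 2 n vertices, and at least 2 |y|²
-- for paths on 3 vertices when X is the larger class.  Everything is done over
-- ℚ, with a rational q below the roots of g₁, …, gₙ in place of βₙ.
--
-- Upper bounds.  For odd m a 2-colouring of the path with three more vertices
-- of one colour is multiplied by the parity of the remaining coordinates; the
-- excess 3 is preserved, and α is at most half of the vertices, rounded up.

open import Algebra.Bundles using (CommutativeRing)
import Algebra.Properties.Semiring.Sum as SemiringSum
import Algebra.Properties.CommutativeMonoid.Sum as CommutativeMonoidSum
open import Data.Nat.Base as ℕ using (ℕ; zero; suc; z≤n; s≤s)
import Data.Nat.Properties as ℕₚ
import Data.List.Properties as Listₚ
import Data.Rational.Unnormalised.Properties as ℚᵘₚ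
open import Data.Fin.Base using (Fin; zero; suc; toℕ; punchIn; punchOut; _↑ˡ_; _↑ʳ_; combine; remQuot)
import Data.Fin.Properties as Finₚ
import Data.Rational.Properties as ℚₚ
open import Data.Integer.Base as ℤ using (ℤ)
import Data.Integer.Properties as ℤₚ
open import Data.Rational.Unnormalised.Base as ℚᵘ using (mkℚᵘ)
open import Data.Bool.Base using (Bool; true; false; if_then_else_; not; _∧_; _∨_; _xor_)
open import Data.List.Base as List using (List; []; _∷_; length)
open import Data.List.Relation.Unary.All as All using (All; []; _∷_)
open import Data.Product.Base using (_×_; _,_; proj₁; proj₂; ∃-syntax; Σ-syntax)
open import Data.Sum.Base using (_⊎_; inj₁; inj₂; [_,_]′)
open import Data.Empty using (⊥; ⊥-elim)
open import Data.Unit.Base using (⊤; tt)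
open import Data.Vec.Functional using (Vector)
open import Function.Base using (_∘_; case_of_; _⟨_⟩_)
open import Level using (0ℓ)
open import Relation.Nullary using (¬_; Dec; yes; no; does)
open import Relation.Nullary.Decidable using (dec⇒maybe; _×-dec_)
open import Relation.Nullary.Negation using (contradiction)
open import Relation.Binary.PropositionalEquality hiding ([_])
open import Tactic.RingSolver using (solve-∀)
open import Tactic.RingSolver.Core.AlmostCommutativeRing using (AlmostCommutativeRing; fromCommutativeRing)

open import Data.Fin.Subset as Subset using (Subset; inside; outside; _∈_; _∉_; _∩_)
import Data.Fin.Subset.Properties as Subsetₚ
open import Data.Vec.Base using ([]; _∷_; here; there; lookup; tabulate)
import Data.Vec.Properties as Vecₚ
import Data.List.Extrema.Nat as Extrema
import Data.List.Membership.Propositional as List∈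
import Data.List.Membership.Propositional.Properties as List∈ₚ
import Data.List.Relation.Unary.All.Properties as Allₚ
import Data.List.Relation.Unary.Any as Any
open import Defs

-- The adjacency matrix of an odd path is singular, so no positive multiple of |y|² bounds |A y|²
-- for every y. Making y vanish on X removes the obstacle for three vertices: off the larger class
-- some coordinate is the middle vertex, and that coordinate alone contributes 2. On paths with two
-- vertices the signing is Huang's signed matrix of the hypercube. For 2 n vertices the squared path
-- matrix splits into the even and the odd positions, two mirror images of one tridiagonal matrix
-- with characteristic polynomial gₙ; this is where βₙ comes from. Rationals below βₙ keep every
-- sign test decidable and keep limits out of the graph argument: βₙ is represented by the left ends
-- of a bisection, and each left end already satisfies the bound. The excess 3 is the least that
-- suffices on N vertices, N odd: it gives |S| = (N + 3)/2 against α ≤ (N + 1)/2.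

module _ where

  open import Data.Rational.Base as ℚ using (ℚ; 0ℚ; 1ℚ; ½; _+_; _*_; _-_; -_; 1/_; _≤_; _<_)

  private
    module Q = CommutativeRing ℚₚ.+-*-commutativeRing

  open SemiringSum Q.semiring using (sum; sum-cong-≗; *-distribˡ-sum; *-distribʳ-sum; sum-replicate-zero)
  open CommutativeMonoidSum Q.+-commutativeMonoid using (∑-distrib-+; ∑-comm; sum-remove)

  ℚ-ring : AlmostCommutativeRing 0ℓ 0ℓ
  ℚ-ring = fromCommutativeRing ℚₚ.+-*-commutativeRing (λ x → dec⇒maybe (0ℚ ℚₚ.≟ x))

  2ℚ : ℚ
  2ℚ = 1ℚ + 1ℚ

  -- Ordered field arithmetic

  ≤⇒0≤ : ∀ {p q} → p ≤ q → 0ℚ ≤ q - p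
  ≤⇒0≤ {p} {q} p≤q = subst (_≤ q - p) (ℚₚ.+-inverseʳ p) (ℚₚ.+-monoˡ-≤ (- p) p≤q)

  <⇒0< : ∀ {p q} → p < q → 0ℚ < q - p
  <⇒0< {p} {q} p<q = subst (_< q - p) (ℚₚ.+-inverseʳ p) (ℚₚ.+-monoˡ-< (- p) p<q)

  -- Many inequalities below are proved by a certificate of this form: an explicit nonnegative
  -- remainder r and a ring identity that exhibits it.
  ≤-by : ∀ {p q r} → 0ℚ ≤ r → q ≡ p + r → p ≤ q
  ≤-by {p} {q} {r} 0≤r eq = subst (p ≤_) (sym eq) (subst (_≤ p + r) (ℚₚ.+-identityʳ p) (ℚₚ.+-monoʳ-≤ p 0≤r))

  <-by : ∀ {p q r} → 0ℚ < r → q ≡ p + r → p < q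
  <-by {p} {q} {r} 0<r eq = subst (p <_) (sym eq) (subst (_< p + r) (ℚₚ.+-identityʳ p) (ℚₚ.+-monoʳ-< p 0<r))

  0≤+ : ∀ {p q} → 0ℚ ≤ p → 0ℚ ≤ q → 0ℚ ≤ p + q
  0≤+ 0≤p 0≤q = ℚₚ.+-mono-≤ 0≤p 0≤q

  0<+ : ∀ {p q} → 0ℚ < p → 0ℚ ≤ q → 0ℚ < p + q
  0<+ 0<p 0≤q = ℚₚ.+-mono-<-≤ 0<p 0≤q

  0≤* : ∀ {p q} → 0ℚ ≤ p → 0ℚ ≤ q → 0ℚ ≤ p * q
  0≤* {p} {q} 0≤p 0≤q = ℚₚ.nonNegative⁻¹ _ {{ℚₚ.nonNeg*nonNeg⇒nonNeg p {{ℚ.nonNegative 0≤p}} q {{ℚ.nonNegative 0≤q}}}}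

  0<* : ∀ {p q} → 0ℚ < p → 0ℚ < q → 0ℚ < p * q
  0<* {p} {q} 0<p 0<q = ℚₚ.positive⁻¹ _ {{ℚₚ.pos*pos⇒pos p {{ℚ.positive 0<p}} q {{ℚ.positive 0<q}}}}

  0≤1 : 0ℚ ≤ 1ℚ
  0≤1 = ℚₚ.nonNegative⁻¹ 1ℚ

  0<1 : 0ℚ < 1ℚ
  0<1 = ℚₚ.positive⁻¹ 1ℚ

  0≤p*p : ∀ p → 0ℚ ≤ p * p
  0≤p*p p = [ (λ h → 0≤* h h) , (λ h → subst (0ℚ ≤_) (eq p) (0≤* (ℚₚ.neg-antimono-≤ h) (ℚₚ.neg-antimono-≤ h))) ]′ (ℚₚ.≤-total 0ℚ p)
    where
    eq : ∀ p → - p * - p ≡ p * p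
    eq = solve-∀ ℚ-ring

  cancel-0≤ : ∀ {p q} → 0ℚ < p → 0ℚ ≤ p * q → 0ℚ ≤ q
  cancel-0≤ {p} {q} 0<p 0≤pq = ℚₚ.*-cancelˡ-≤-pos p {{ℚ.positive 0<p}} (subst (_≤ p * q) (sym (ℚₚ.*-zeroʳ p)) 0≤pq)

  cancel-≡0 : ∀ p {q} → p ≢ 0ℚ → p * q ≡ 0ℚ → q ≡ 0ℚ
  cancel-≡0 p {q} p≢0 pq≡0 = begin
    q                 ≡⟨ ℚₚ.*-identityˡ q ⟨
    1ℚ * q            ≡⟨ cong (_* q) (ℚₚ.*-inverseˡ p) ⟨
    ((1/ p) * p) * q  ≡⟨ ℚₚ.*-assoc (1/ p) p q ⟩
    (1/ p) * (p * q)  ≡⟨ cong ((1/ p) *_) pq≡0 ⟩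
    (1/ p) * 0ℚ       ≡⟨ ℚₚ.*-zeroʳ (1/ p) ⟩
    0ℚ                ∎
    where
    open ≡-Reasoning
    instance _ = ℚ.≢-nonZero p≢0

  0<p*p : ∀ p → p ≢ 0ℚ → 0ℚ < p * p
  0<p*p p p≢0 = [ (λ h → h) , (λ h → contradiction (cancel-≡0 p p≢0 (ℚₚ.≤-antisym h (0≤p*p p))) p≢0) ]′
    (case ℚₚ._<?_ 0ℚ (p * p) of λ { (yes h) → inj₁ h ; (no h) → inj₂ (ℚₚ.≮⇒≥ h) })

  -- By recursion, so that it computes on successors.

  fromℕ : ℕ → ℚ
  fromℕ zero    = 0ℚ
  fromℕ (suc n) = 1ℚ + fromℕ n

  0≤fromℕ : ∀ n → 0ℚ ≤ fromℕ n
  0≤fromℕ zero    = ℚₚ.≤-refl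
  0≤fromℕ (suc n) = 0≤+ 0≤1 (0≤fromℕ n)

  0<fromℕ : ∀ n → 0ℚ < fromℕ (suc n)
  0<fromℕ n = 0<+ 0<1 (0≤fromℕ n)

  fromℕ-+ : ∀ m n → fromℕ (m ℕ.+ n) ≡ fromℕ m + fromℕ n
  fromℕ-+ zero    n = sym (ℚₚ.+-identityˡ (fromℕ n))
  fromℕ-+ (suc m) n = trans (cong (1ℚ +_) (fromℕ-+ m n)) (sym (ℚₚ.+-assoc 1ℚ (fromℕ m) (fromℕ n)))

  fromℕ-* : ∀ m n → fromℕ (m ℕ.* n) ≡ fromℕ m * fromℕ n
  fromℕ-* zero    n = sym (ℚₚ.*-zeroˡ (fromℕ n))
  fromℕ-* (suc m) n = trans (fromℕ-+ n (m ℕ.* n))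
    (trans (cong (fromℕ n +_) (fromℕ-* m n)) (eq (fromℕ m) (fromℕ n)))
    where
    eq : ∀ a b → b + a * b ≡ (1ℚ + a) * b
    eq = solve-∀ ℚ-ring

  fromℕ-mono-≤ : ∀ {m n} → m ℕ.≤ n → fromℕ m ≤ fromℕ n
  fromℕ-mono-≤ {n = n} z≤n = 0≤fromℕ n
  fromℕ-mono-≤ (s≤s h) = ℚₚ.+-monoʳ-≤ 1ℚ (fromℕ-mono-≤ h)

  fromℕ-cancel-≤ : ∀ {m n} → fromℕ m ≤ fromℕ n → m ℕ.≤ n
  fromℕ-cancel-≤ {m} {n} h with m ℕₚ.≤? n
  ... | yes m≤n = m≤n
  ... | no  m≰n = contradiction (ℚₚ.<-≤-trans lt (ℚₚ.≤-trans (fromℕ-mono-≤ (ℕₚ.≰⇒> m≰n)) h)) (ℚₚ.<-irrefl refl)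
    where
    lt : fromℕ n < fromℕ (suc n)
    lt = <-by 0<1 (ℚₚ.+-comm 1ℚ (fromℕ n))

  fromℕ≡/1 : ∀ n → fromℕ n ≡ (ℤ.+ n) ℚ./ 1
  fromℕ≡/1 zero    = refl
  fromℕ≡/1 (suc n) = trans (cong (1ℚ +_) (fromℕ≡/1 n)) (ℚₚ.toℚᵘ-injective (begin
    ℚ.toℚᵘ (1ℚ + (ℤ.+ n) ℚ./ 1)                  ≈⟨ ℚₚ.toℚᵘ-homo-+ 1ℚ ((ℤ.+ n) ℚ./ 1) ⟩
    ℚ.toℚᵘ 1ℚ ℚᵘ.+ ℚ.toℚᵘ ((ℤ.+ n) ℚ./ 1)        ≈⟨ ℚᵘₚ.+-congʳ (ℚ.toℚᵘ 1ℚ) (ℚₚ.toℚᵘ-fromℚᵘ (mkℚᵘ (ℤ.+ n) 0)) ⟩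
    ℚ.toℚᵘ 1ℚ ℚᵘ.+ mkℚᵘ (ℤ.+ n) 0                ≈⟨ ℚᵘ.*≡* (cong (ℤ._* (ℤ.+ 1)) (cong (ℤ._+_ (ℤ.+ 1)) (ℤₚ.*-identityʳ (ℤ.+ n)))) ⟩
    mkℚᵘ (ℤ.+ suc n) 0                           ≈⟨ ℚₚ.toℚᵘ-fromℚᵘ (mkℚᵘ (ℤ.+ suc n) 0) ⟨
    ℚ.toℚᵘ ((ℤ.+ suc n) ℚ./ 1)                   ∎))
    where

    open ℚᵘₚ.≃-Reasoning

  -- Finite sums

  ∑-*ˡ : ∀ {n} c (F : Fin n → ℚ) → sum (λ i → c * F i) ≡ c * sum F
  ∑-*ˡ c F = sym (*-distribˡ-sum c F)

  ∑-0 : ∀ {n} {F : Fin n → ℚ} → (∀ i → F i ≡ 0ℚ) → sum F ≡ 0ℚ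
  ∑-0 {n} h = trans (sum-cong-≗ h) (sum-replicate-zero n)

  ∑-mono : ∀ {n} {F G : Fin n → ℚ} → (∀ i → F i ≤ G i) → sum F ≤ sum G
  ∑-mono {zero}  h = ℚₚ.≤-refl
  ∑-mono {suc n} h = ℚₚ.+-mono-≤ (h zero) (∑-mono (h ∘ suc))

  0≤∑ : ∀ {n} {F : Fin n → ℚ} → (∀ i → 0ℚ ≤ F i) → 0ℚ ≤ sum F
  0≤∑ {n} {F} h = subst (_≤ sum F) (sum-replicate-zero n) (∑-mono h)

  0<∑ : ∀ {n} {F : Fin n → ℚ} → (∀ i → 0ℚ ≤ F i) → ∀ j → 0ℚ < F j → 0ℚ < sum F
  0<∑ h zero    h′ = 0<+ h′ (0≤∑ (h ∘ suc))
  0<∑ h (suc j) h′ = ℚₚ.+-mono-≤-< (h zero) (0<∑ (h ∘ suc) j h′)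

  ∑-const : ∀ n c → sum {n} (λ _ → c) ≡ fromℕ n * c
  ∑-const zero    c = sym (ℚₚ.*-zeroˡ c)
  ∑-const (suc n) c = trans (cong (c +_) (∑-const n c)) (eq (fromℕ n) c)
    where
    eq : ∀ a c → c + a * c ≡ (1ℚ + a) * c
    eq = solve-∀ ℚ-ring

  ∑-single : ∀ {n} {F : Fin n → ℚ} i → (∀ j → j ≢ i → F j ≡ 0ℚ) → sum F ≡ F i
  ∑-single {F = F} zero    h = trans (cong (F zero +_) (∑-0 (λ j → h (suc j) λ ()))) (ℚₚ.+-identityʳ _)
  ∑-single {F = F} (suc i) h = trans (cong₂ _+_ (h zero λ ()) (∑-single i (λ j j≢i → h (suc j) (j≢i ∘ Finₚ.suc-injective))))
                             (ℚₚ.+-identityˡ _)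

  ∑-↑ : ∀ m {n} (F : Fin (m ℕ.+ n) → ℚ) → sum F ≡ sum (λ i → F (i ↑ˡ n)) + sum (λ i → F (m ↑ʳ i))
  ∑-↑ zero    F = sym (ℚₚ.+-identityˡ _)
  ∑-↑ (suc m) F = trans (cong (F zero +_) (∑-↑ m (F ∘ suc))) (sym (ℚₚ.+-assoc (F zero) _ _))

  ∑-combine : ∀ m {n} (F : Fin (m ℕ.* n) → ℚ) → sum F ≡ sum (λ i → sum (λ j → F (combine {m} {n} i j)))
  ∑-combine zero    F = refl
  ∑-combine (suc m) {n} F = trans (∑-↑ n F) (cong (sum (λ j → F (j ↑ˡ (m ℕ.* n))) +_) (∑-combine m (F ∘ (n ↑ʳ_))))

  [_]ᵇ : Bool → ℚ
  [ true ]ᵇ  = 1ℚ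
  [ false ]ᵇ = 0ℚ

  0≤[]ᵇ : ∀ b → 0ℚ ≤ [ b ]ᵇ
  0≤[]ᵇ true  = 0≤1
  0≤[]ᵇ false = ℚₚ.≤-refl

  -- Linear algebra

  _·_ : ∀ {n} → Vector ℚ n → Vector ℚ n → ℚ
  r · y = sum (λ j → r j * y j)

  private
    eliminate : ∀ {n} → Fin (suc n) → (r s : Vector ℚ (suc n)) → Vector ℚ n
    eliminate p r s j = r p * s (punchIn p j) - s p * r (punchIn p j)

  -- Gaussian elimination without division: the pivot variable is solved for
  -- after the other ones have been scaled by the pivot.
  kernel : ∀ m n (rows : List (Vector ℚ n)) → length rows ≡ m → m ℕ.< n →
           Σ[ y ∈ Vector ℚ n ] (∃[ j ] y j ≢ 0ℚ) × All (λ r → r · y ≡ 0ℚ) rows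
  kernel zero (suc n) [] refl _ = (λ _ → 1ℚ) , (zero , λ ()) , []
  kernel (suc m) (suc n) (r ∷ rows) len (s≤s m<n) with Finₚ.any? (λ p → dec-≢0 (r p))
    where
    dec-≢0 : ∀ x → Dec (x ≢ 0ℚ)
    dec-≢0 x with x ℚₚ.≟ 0ℚ
    ... | yes e = no λ ¬e → ¬e e
    ... | no ¬e = yes ¬e
  -- Without a pivot the row is zero and its equation holds for every y, so the remaining rows are
  -- solved in the same unknowns.
  ... | no ¬p = let y , y≢0 , eqs = kernel m (suc n) rows (ℕₚ.suc-injective len) (ℕₚ.m<n⇒m<1+n m<n) in
      y , y≢0 , ∑-0 (λ j → trans (cong (_* y j) (r≡0 j)) (ℚₚ.*-zeroˡ (y j))) ∷ eqs
    where
    r≡0 : ∀ j → r j ≡ 0ℚ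
    r≡0 j with r j ℚₚ.≟ 0ℚ
    ... | yes e = e
    ... | no ¬e = contradiction (j , ¬e) ¬p
  ... | yes (p , rp≢0) = y , nonzero , row-r ∷ others rows eqs
    where
    rec = kernel m n (List.map (eliminate p r) rows)
            (trans (Listₚ.length-map (eliminate p r) rows) (ℕₚ.suc-injective len)) m<n

    z = proj₁ rec
    eqs : All (λ t → t · z ≡ 0ℚ) (List.map (eliminate p r) rows)
    eqs = proj₂ (proj₂ rec)
    r′ : Vector ℚ n
    r′ = r ∘ punchIn p
    y : Vector ℚ (suc n)
    y k with p Finₚ.≟ k
    ... | yes _   = - (r′ · z)
    ... | no p≢k = r p * z (punchOut p≢k)
    y-pivot : y p ≡ - (r′ · z)
    y-pivot with p Finₚ.≟ p
    ... | yes _  = refl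
    ... | no p≢p = contradiction refl p≢p
    y-other : ∀ j → y (punchIn p j) ≡ r p * z j
    y-other j with p Finₚ.≟ punchIn p j
    ... | yes e  = contradiction (sym e) (Finₚ.punchInᵢ≢i p j)
    ... | no p≢k = cong (λ i → r p * z i) (trans (Finₚ.punchOut-cong p refl) (Finₚ.punchOut-punchIn p))
    nonzero : ∃[ j ] y j ≢ 0ℚ
    nonzero = let j , zj≢0 = proj₁ (proj₂ rec) in
      punchIn p j , λ e → zj≢0 (cancel-≡0 (r p) rp≢0 (trans (sym (y-other j)) e))
    expand : ∀ s → s · y ≡ s p * - (r′ · z) + r p * ((s ∘ punchIn p) · z)
    expand s = begin
      s · y                                                       ≡⟨ sum-remove {i = p} (λ j → s j * y j) ⟩
      s p * y p + sum (λ j → s (punchIn p j) * y (punchIn p j))   ≡⟨ cong₂ _+_ (cong (s p *_) y-pivot) (sum-cong-≗ λ j → trans (cong (s (punchIn p j) *_) (y-other j)) (eq (s (punchIn p j)) (r p) (z j))) ⟩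
      s p * - (r′ · z) + sum (λ j → r p * (s (punchIn p j) * z j)) ≡⟨ cong (s p * - (r′ · z) +_) (∑-*ˡ (r p) (λ j → s (punchIn p j) * z j)) ⟩
      s p * - (r′ · z) + r p * ((s ∘ punchIn p) · z)              ∎
      where
      open ≡-Reasoning
      eq : ∀ a b c → a * (b * c) ≡ b * (a * c)
      eq = solve-∀ ℚ-ring
    row-r : r · y ≡ 0ℚ
    row-r = trans (expand r) (eq (r p) (r′ · z))
      where
      eq : ∀ a b → a * - b + a * b ≡ 0ℚ
      eq = solve-∀ ℚ-ring
    eliminate-· : ∀ s → eliminate p r s · z ≡ s · y
    eliminate-· s = begin
      sum (λ j → (r p * s (punchIn p j) - s p * r (punchIn p j)) * z j)
        ≡⟨ sum-cong-≗ (λ j → eq (r p) (s (punchIn p j)) (s p) (r (punchIn p j)) (z j)) ⟩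
      sum (λ j → r p * (s (punchIn p j) * z j) + - s p * (r (punchIn p j) * z j))
        ≡⟨ ∑-distrib-+ (λ j → r p * (s (punchIn p j) * z j)) (λ j → - s p * (r (punchIn p j) * z j)) ⟩
      sum (λ j → r p * (s (punchIn p j) * z j)) + sum (λ j → - s p * (r (punchIn p j) * z j))
        ≡⟨ cong₂ _+_ (∑-*ˡ (r p) (λ j → s (punchIn p j) * z j)) (∑-*ˡ (- s p) (λ j → r (punchIn p j) * z j)) ⟩
      r p * ((s ∘ punchIn p) · z) + - s p * (r′ · z)
        ≡⟨ eq′ (r p) ((s ∘ punchIn p) · z) (s p) (r′ · z) ⟩
      s p * - (r′ · z) + r p * ((s ∘ punchIn p) · z)
        ≡⟨ expand s ⟨
      s · y ∎
      where
      open ≡-Reasoning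
      eq : ∀ a b c d e → (a * b - c * d) * e ≡ a * (b * e) + - c * (d * e)
      eq = solve-∀ ℚ-ring
      eq′ : ∀ a b c d → a * b + - c * d ≡ c * - d + a * b
      eq′ = solve-∀ ℚ-ring
    others : ∀ ss → All (λ t → t · z ≡ 0ℚ) (List.map (eliminate p r) ss) → All (λ t → t · y ≡ 0ℚ) ss
    others []       []       = []
    others (s ∷ ss) (e ∷ es) = trans (sym (eliminate-· s)) e ∷ others ss es

  -- Graph invariants

  does-true : ∀ {A : Set} (A? : Dec A) → A → does A? ≡ true
  does-true (yes _) _ = refl
  does-true (no ¬a) a = contradiction a ¬a

  does-true⁻ : ∀ {A : Set} (A? : Dec A) → does A? ≡ true → A
  does-true⁻ (yes a) _ = a

  does-false : ∀ {A : Set} (A? : Dec A) → ¬ A → does A? ≡ false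
  does-false (yes a) ¬a = contradiction a ¬a
  does-false (no _)  _  = refl

  adjacency : ∀ {n} → Graph n → Fin n → Fin n → ℚ
  adjacency G i j = [ does (adj? G i j) ]ᵇ

  adjacency-sym : ∀ {n} (G : Graph n) i j → adjacency G i j ≡ adjacency G j i
  adjacency-sym G i j with adj? G i j | adj? G j i
  ... | yes _  | yes _  = refl
  ... | no _   | no _   = refl
  ... | yes ij | no ¬ji = contradiction (adj-sym G ij) ¬ji
  ... | no ¬ij | yes ji = contradiction (adj-sym G ji) ¬ij

  ∈-subsets : ∀ {n} (S : Subset n) → S List∈.∈ subsets n
  ∈-subsets []            = Any.here refl
  ∈-subsets (inside  ∷ S) = List∈ₚ.∈-++⁺ˡ (List∈ₚ.∈-map⁺ (inside ∷_) (∈-subsets S))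
  ∈-subsets {suc n} (outside ∷ S) = List∈ₚ.∈-++⁺ʳ (List.map (inside ∷_) (subsets n)) (List∈ₚ.∈-map⁺ (outside ∷_) (∈-subsets S))

  module _ {n} (G : Graph n) where

    ∣I∣≤α : ∀ {I} → Independent G I → Subset.∣ I ∣ ℕ.≤ α G
    ∣I∣≤α {I} ind = All.lookup (Extrema.xs≤max 0 _)
      (List∈ₚ.∈-map⁺ Subset.∣_∣ (List∈ₚ.∈-filter⁺ (independent? G) (∈-subsets I) ind))

    α< : ∀ {b} → (∀ I → Independent G I → Subset.∣ I ∣ ℕ.< b) → α G ℕ.< b
    α< h = Extrema.max<v⁺ (ℕₚ.≤-<-trans z≤n (h Subset.⊥ λ u _ u∈⊥ → contradiction u∈⊥ Subsetₚ.∉⊥))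
      (Allₚ.map⁺ (All.map (λ {I} → h I) (Allₚ.all-filter (independent? G) (subsets n))))

    degree≤Δ : ∀ u → degree G u ℕ.≤ Δ G
    degree≤Δ u = All.lookup (Extrema.xs≤max 0 (List.map (degree G) (List.allFin n))) (List∈ₚ.∈-map⁺ (degree G) (List∈ₚ.∈-allFin u))

    Δ≤ : ∀ {b} → (∀ u → degree G u ℕ.≤ b) → Δ G ℕ.≤ b
    Δ≤ h = Extrema.max≤v⁺ {xs = List.map (degree G) (List.allFin n)} z≤n (Allₚ.map⁺ (All.tabulate (λ {u} _ → h u)))

    private
      is-α+1? = λ (S : Subset n) → Subset.∣ S ∣ ℕₚ.≟ suc (α G)

    -- The premise `P n` covers the value of `min` at the empty list, so that the existence of a set
    -- of size α + 1 never has to be shown for a lower bound.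
    f-elim : (P : ℕ → Set) → P n → (∀ S → Subset.∣ S ∣ ≡ suc (α G) → P (Δ (G [ S ]))) → P (f G)
    f-elim P Pn h = Extrema.argmin-all (λ d → d) {P = P} Pn
      (Allₚ.map⁺ (All.map (λ {S} → h S) (Allₚ.all-filter is-α+1? (subsets n))))

    f≤Δ : ∀ S → Subset.∣ S ∣ ≡ suc (α G) → f G ℕ.≤ Δ (G [ S ])
    f≤Δ S eq = All.lookup (Extrema.min≤xs n _)
      (List∈ₚ.∈-map⁺ (λ S → Δ (G [ S ])) (List∈ₚ.∈-filter⁺ is-α+1? (∈-subsets S) eq))

  element∈ : ∀ {n} (S : Subset n) i → element S i ∈ S
  element∈ (inside  ∷ S) zero    = here
  element∈ (inside  ∷ S) (suc i) = there (element∈ S i)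
  element∈ (outside ∷ S) i       = there (element∈ S i)

  element-injective : ∀ {n} (S : Subset n) {i j} → element S i ≡ element S j → i ≡ j
  element-injective (inside  ∷ S) {zero}  {zero}  e = refl
  element-injective (inside  ∷ S) {suc i} {suc j} e = cong suc (element-injective S (Finₚ.suc-injective e))
  element-injective (outside ∷ S) e = element-injective S (Finₚ.suc-injective e)

  element-surjective : ∀ {n} (S : Subset n) {u} → u ∈ S → ∃[ i ] element S i ≡ u
  element-surjective (inside ∷ S)  here      = zero , refl
  element-surjective (inside ∷ S)  (there m) = let i , e = element-surjective S m in suc i , cong suc e
  element-surjective (outside ∷ S) (there m) = let i , e = element-surjective S m in i , cong suc e

  -- Translates a degree inside an induced subgraph, counted over indices, into the size of an
  -- intersection in the ambient graph.
  ∣tabulate-element∣ : ∀ {n} (S : Subset n) (b : Fin n → Bool) →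
                       Subset.∣ tabulate (b ∘ element S) ∣ ≡ Subset.∣ S ∩ tabulate b ∣
  ∣tabulate-element∣ []            b = refl
  ∣tabulate-element∣ (inside  ∷ S) b with b zero
  ... | true  = cong suc (∣tabulate-element∣ S (b ∘ suc))
  ... | false = ∣tabulate-element∣ S (b ∘ suc)
  ∣tabulate-element∣ (outside ∷ S) b = ∣tabulate-element∣ S (b ∘ suc)

  subset-of-size : ∀ {n} (S : Subset n) k → k ℕ.≤ Subset.∣ S ∣ → ∃[ T ] T Subset.⊆ S × Subset.∣ T ∣ ≡ k
  subset-of-size {n} S zero _ = Subset.⊥ , (λ m → contradiction m Subsetₚ.∉⊥) , Subsetₚ.∣⊥∣≡0 n
  subset-of-size (inside ∷ S)  (suc k) (s≤s h) =
    let T , T⊆S , e = subset-of-size S k h in inside ∷ T , Subsetₚ.in⊆in T⊆S , cong suc e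
  subset-of-size (outside ∷ S) (suc k) h =
    let T , T⊆S , e = subset-of-size S (suc k) h in outside ∷ T , Subsetₚ.out⊆ T⊆S , e

  ∣p∣≡∑ : ∀ {n} (S : Subset n) → fromℕ Subset.∣ S ∣ ≡ sum ([_]ᵇ ∘ lookup S)
  ∣p∣≡∑ []            = refl
  ∣p∣≡∑ (inside  ∷ S) = cong (1ℚ +_) (∣p∣≡∑ S)
  ∣p∣≡∑ (outside ∷ S) = trans (∣p∣≡∑ S) (sym (ℚₚ.+-identityˡ _))

  ∣tabulate∣≡∑ : ∀ {n} (b : Fin n → Bool) → fromℕ Subset.∣ tabulate b ∣ ≡ sum ([_]ᵇ ∘ b)
  ∣tabulate∣≡∑ b = trans (∣p∣≡∑ (tabulate b)) (sum-cong-≗ (λ i → cong [_]ᵇ (Vecₚ.lookup∘tabulate b i)))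

  ∈⇒lookup : ∀ {n} {S : Subset n} {u} → u ∈ S → lookup S u ≡ true
  ∈⇒lookup = Vecₚ.[]=⇒lookup

  lookup⇒∈ : ∀ {n} {S : Subset n} {u} → lookup S u ≡ true → u ∈ S
  lookup⇒∈ {S = S} {u} = Vecₚ.lookup⇒[]= u S

  ∈-tabulate : ∀ {n} {b : Fin n → Bool} {u} → b u ≡ true → u ∈ tabulate b
  ∈-tabulate {b = b} {u} e = lookup⇒∈ (trans (Vecₚ.lookup∘tabulate b u) e)

  ∈-tabulate⁻ : ∀ {n} {b : Fin n → Bool} {u} → u ∈ tabulate b → b u ≡ true
  ∈-tabulate⁻ {b = b} {u} m = trans (sym (Vecₚ.lookup∘tabulate b u)) (∈⇒lookup m)

  module _ {n} (G : Graph n) where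

    Δ[]≤ : ∀ S {b} → (∀ u → u ∈ S → Subset.∣ S ∩ neighbours G u ∣ ℕ.≤ b) → Δ (G [ S ]) ℕ.≤ b
    Δ[]≤ S h = Δ≤ (G [ S ]) λ i → subst (ℕ._≤ _)
      (sym (∣tabulate-element∣ S (λ v → does (adj? G (element S i) v)))) (h _ (element∈ S i))

    -- The minimum ranges over sets of exactly α + 1 vertices. A larger S can be cut down to such a
    -- set, and this raises no degree.
    f≤ : ∀ S {b} → α G ℕ.< Subset.∣ S ∣ → (∀ u → u ∈ S → Subset.∣ S ∩ neighbours G u ∣ ℕ.≤ b) → f G ℕ.≤ b
    f≤ S α<∣S∣ h = let T , T⊆S , e = subset-of-size S (suc (α G)) α<∣S∣ in
      ℕₚ.≤-trans (f≤Δ G T e) (Δ[]≤ T λ u u∈T → ℕₚ.≤-trans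
        (Subsetₚ.p⊆q⇒∣p∣≤∣q∣ (λ m → let m₁ , m₂ = Subsetₚ.x∈p∩q⁻ T _ m in Subsetₚ.x∈p∩q⁺ (T⊆S m₁ , m₂)))
        (h u (T⊆S u∈T)))

    Δ[]≥1 : ∀ S → Subset.∣ S ∣ ≡ suc (α G) → 1 ℕ.≤ Δ (G [ S ])
    Δ[]≥1 S e with Δ (G [ S ]) in eq
    ... | suc _ = s≤s z≤n
    ... | zero  = contradiction (∣I∣≤α G independent) (ℕₚ.<⇒≱ (ℕₚ.≤-reflexive (sym e)))
      where
      independent : Independent G S
      independent u v u∈S v∈S u~v with element-surjective S u∈S | element-surjective S v∈S
      ... | i , refl | j , refl = contradiction
        (ℕₚ.≤-trans (ℕₚ.≤-<-trans z≤n (Subsetₚ.x∈p⇒∣p-x∣<∣p∣ {x = j} (∈-tabulate (does-true (adj? (G [ S ]) i j) u~v))))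
                    (subst (degree (G [ S ]) i ℕ.≤_) eq (degree≤Δ (G [ S ]) i))) λ ()

  -- The spectral argument

  module _ {s d} (H : Graph s) (a : Fin s → Fin s → ℚ)
           (a² : ∀ i j → a i j * a i j ≡ [ does (adj? H i j) ]ᵇ)
           (Δ≤d : Δ H ℕ.≤ d) (0<d : 0ℚ < fromℕ d) where

    private
      D : ℚ
      D = fromℕ d

      B : Fin s → Fin s → ℚ
      B = adjacency H

      B≡1⊎B≡0 : ∀ i j → B i j ≡ 1ℚ ⊎ B i j ≡ 0ℚ
      B≡1⊎B≡0 i j with does (adj? H i j)
      ... | true  = inj₁ refl
      ... | false = inj₂ refl

      0≤B : ∀ i j → 0ℚ ≤ B i j
      0≤B i j = 0≤[]ᵇ (does (adj? H i j))

      Ba : ∀ i j → B i j * a i j ≡ a i j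
      Ba i j with B≡1⊎B≡0 i j
      ... | inj₁ e = trans (cong (_* a i j) e) (ℚₚ.*-identityˡ (a i j))
      ... | inj₂ e with a i j ℚₚ.≟ 0ℚ
      ...   | yes a≡0 = trans (cong (B i j *_) a≡0) (trans (ℚₚ.*-zeroʳ (B i j)) (sym a≡0))
      ...   | no  a≢0 = contradiction (cancel-≡0 (a i j) a≢0 (trans (a² i j) e)) a≢0

      Baa : ∀ i j → B i j * (a i j * a i j) ≡ B i j
      Baa i j = trans (sym (ℚₚ.*-assoc (B i j) (a i j) (a i j))) (trans (cong (_* a i j) (Ba i j)) (a² i j))

      ∑B≤D : ∀ i → sum (B i) ≤ D
      ∑B≤D i = subst (_≤ D) (∣tabulate∣≡∑ (λ j → does (adj? H i j))) (fromℕ-mono-≤ (ℕₚ.≤-trans (degree≤Δ H i) Δ≤d))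

    -- Summing 0 ≤ (aᵢⱼ wᵢ − d zⱼ)² over all edges, where w = a z, gives
    -- d |w|² ≤ d³ |z|².
    ∣az∣²≤d²∣z∣² : ∀ z → sum (λ i → (a i · z) * (a i · z)) ≤ D * D * (z · z)
    ∣az∣²≤d²∣z∣² z = ≤-by {r = D * D * Z - W} (cancel-0≤ 0<d (ℚₚ.≤-trans (0≤∑ λ i → 0≤∑ (0≤t i)) total≤)) (eq (D * D * Z) W)
      where
      eq : ∀ x y → x ≡ y + (x - y)
      eq = solve-∀ ℚ-ring

      w : Fin s → ℚ
      w i = a i · z

      W Z : ℚ
      W = sum (λ i → w i * w i)
      Z = z · z

      t : Fin s → Fin s → ℚ
      t i j = B i j * ((a i j * w i - D * z j) * (a i j * w i - D * z j))

      0≤t : ∀ i j → 0ℚ ≤ t i j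
      0≤t i j = 0≤* (0≤B i j) (0≤p*p (a i j * w i - D * z j))

      u : Fin s → Fin s → ℚ
      u i j = B i j * (z j * z j)

      expand : ∀ i j → t i j ≡ (w i * w i) * B i j + (- (2ℚ * D * w i) * (a i j * z j) + D * D * u i j)
      expand i j = trans (eq₁ (B i j) (a i j) (w i) D (z j))
        (cong₂ (λ p q → (w i * w i) * p + (- (2ℚ * D * w i) * (q * z j) + D * D * u i j)) (Baa i j) (Ba i j))
        where
        eq₁ : ∀ b a w D z → b * ((a * w - D * z) * (a * w - D * z)) ≡
              (w * w) * (b * (a * a)) + (- ((1ℚ + 1ℚ) * D * w) * ((b * a) * z) + D * D * (b * (z * z)))
        eq₁ = solve-∀ ℚ-ring

      row≡ : ∀ i → sum (t i) ≡ (w i * w i) * sum (B i) + (- (2ℚ * D * w i) * w i + D * D * sum (u i))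
      row≡ i = begin
        sum (t i)
          ≡⟨ sum-cong-≗ (expand i) ⟩
        sum (λ j → (w i * w i) * B i j + (- (2ℚ * D * w i) * (a i j * z j) + D * D * u i j))
          ≡⟨ ∑-distrib-+ (λ j → (w i * w i) * B i j) (λ j → - (2ℚ * D * w i) * (a i j * z j) + D * D * u i j) ⟩
        sum (λ j → (w i * w i) * B i j) + sum (λ j → - (2ℚ * D * w i) * (a i j * z j) + D * D * u i j)
          ≡⟨ cong₂ _+_ (∑-*ˡ (w i * w i) (B i))
               (trans (∑-distrib-+ (λ j → - (2ℚ * D * w i) * (a i j * z j)) (λ j → D * D * u i j))
                 (cong₂ _+_ (∑-*ˡ (- (2ℚ * D * w i)) (λ j → a i j * z j)) (∑-*ˡ (D * D) (u i)))) ⟩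
        (w i * w i) * sum (B i) + (- (2ℚ * D * w i) * w i + D * D * sum (u i)) ∎
        where open ≡-Reasoning

      -- The row sum of B is at most D, so the first part is at most D wᵢ², against -2 D wᵢ² from
      -- the mixed part.
      row≤ : ∀ i → sum (t i) ≤ - D * (w i * w i) + D * D * sum (u i)
      row≤ i = subst (_≤ - D * (w i * w i) + D * D * sum (u i)) (sym (row≡ i))
        (≤-by (0≤* (0≤p*p (w i)) (≤⇒0≤ (∑B≤D i))) (eq₁ D (w i) (sum (B i)) (D * D * sum (u i))))
        where
        eq₁ : ∀ D w b q → - D * (w * w) + q ≡ (w * w) * b + (- ((1ℚ + 1ℚ) * D * w) * w + q) + (w * w) * (D - b)
        eq₁ = solve-∀ ℚ-ring

      -- Once the sums are exchanged, the symmetry of B turns the column sums into degrees.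
      ∑u≤ : sum (λ i → sum (u i)) ≤ D * Z
      ∑u≤ = subst₂ _≤_ (sym (trans (∑-comm u) (sum-cong-≗ column))) (∑-*ˡ D (λ j → z j * z j))
        (∑-mono λ j → ℚₚ.*-monoʳ-≤-nonNeg (z j * z j) {{ℚ.nonNegative (0≤p*p (z j))}} (∑B≤D j))
        where
        column : ∀ j → sum (λ i → u i j) ≡ sum (B j) * (z j * z j)
        column j = trans (sum-cong-≗ (λ i → cong (_* (z j * z j)) (adjacency-sym H i j))) (sym (*-distribʳ-sum (z j * z j) (B j)))

      total≤ : sum (λ i → sum (t i)) ≤ D * (D * D * Z - W)
      total≤ = begin
        sum (λ i → sum (t i))
          ≤⟨ ∑-mono row≤ ⟩
        sum (λ i → - D * (w i * w i) + D * D * sum (u i))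
          ≡⟨ trans (∑-distrib-+ (λ i → - D * (w i * w i)) (λ i → D * D * sum (u i)))
               (cong₂ _+_ (∑-*ˡ (- D) (λ i → w i * w i)) (∑-*ˡ (D * D) (λ i → sum (u i)))) ⟩
        - D * W + D * D * sum (λ i → sum (u i))
          ≤⟨ ℚₚ.+-monoʳ-≤ (- D * W) (ℚₚ.*-monoˡ-≤-nonNeg (D * D) {{ℚ.nonNegative (0≤p*p D)}} ∑u≤) ⟩
        - D * W + D * D * (D * Z)
          ≡⟨ eq₁ D W Z ⟩
        D * (D * D * Z - W) ∎
        where
        open ℚₚ.≤-Reasoning
        eq₁ : ∀ D W Z → - D * W + D * D * (D * Z) ≡ D * (D * D * Z - W)
        eq₁ = solve-∀ ℚ-ring

  extend : ∀ {n} (S : Subset n) → Vector ℚ Subset.∣ S ∣ → Vector ℚ n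
  extend (inside  ∷ S) z zero    = z zero
  extend (inside  ∷ S) z (suc u) = extend S (z ∘ suc) u
  extend (outside ∷ S) z zero    = 0ℚ
  extend (outside ∷ S) z (suc u) = extend S z u

  extend-element : ∀ {n} (S : Subset n) z i → extend S z (element S i) ≡ z i
  extend-element (inside  ∷ S) z zero    = refl
  extend-element (inside  ∷ S) z (suc i) = extend-element S (z ∘ suc) i
  extend-element (outside ∷ S) z i       = extend-element S z i

  extend-∉ : ∀ {n} (S : Subset n) z {u} → u ∉ S → extend S z u ≡ 0ℚ
  extend-∉ (inside  ∷ S) z {zero}  u∉ = contradiction here u∉
  extend-∉ (inside  ∷ S) z {suc u} u∉ = extend-∉ S (z ∘ suc) (u∉ ∘ there)
  extend-∉ (outside ∷ S) z {zero}  u∉ = refl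
  extend-∉ (outside ∷ S) z {suc u} u∉ = extend-∉ S z (u∉ ∘ there)

  ∑-element : ∀ {n} (S : Subset n) {F : Fin n → ℚ} → (∀ {u} → u ∉ S → F u ≡ 0ℚ) → sum F ≡ sum (F ∘ element S)
  ∑-element []                _ = refl
  ∑-element (inside  ∷ S) {F} h = cong (F zero +_) (∑-element S (λ u∉ → h λ { (there m) → u∉ m }))
  ∑-element (outside ∷ S) {F} h = trans (cong₂ _+_ (h λ ()) (∑-element S (λ u∉ → h λ { (there m) → u∉ m }))) (ℚₚ.+-identityˡ _)

  -- A vector y ≠ 0 supported on S, vanishing on the colour class of false, and
  -- with a y supported on S exists by a dimension count: one equation for each
  -- vertex of that class is enough, and S is larger.
  spectral-bound : ∀ {n} (G : Graph n) (a : Fin n → Fin n → ℚ) (colour : Fin n → Bool) →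
    (∀ u v → a u v * a u v ≡ [ does (adj? G u v) ]ᵇ) →
    (∀ u v → Adj G u v → colour u ≢ colour v) →
    ∀ c → (∀ y → (∀ u → colour u ≡ false → y u ≡ 0ℚ) → c * (y · y) ≤ sum (λ u → (a u · y) * (a u · y))) →
    ∀ S → Subset.∣ tabulate (not ∘ colour) ∣ ℕ.< Subset.∣ S ∣ →
    ∀ d → 1 ℕ.≤ d → Δ (G [ S ]) ℕ.≤ d → c ≤ fromℕ d * fromℕ d
  spectral-bound {n} G a colour a² proper c bound S ∣X∣<∣S∣ (suc d-1) (s≤s z≤n) Δ≤d =
    ℚₚ.*-cancelʳ-≤-pos (z · z) {{ℚ.positive 0<z·z}} (begin
      c * (z · z)                                       ≡⟨ cong (c *_) y·y ⟨
      c * (y · y)                                       ≤⟨ bound y y-false ⟩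
      sum (λ u → (a u · y) * (a u · y))                 ≡⟨ ∑-element S (λ u∉ → trans (cong (_* (a _ · y)) (ay-∉ u∉)) (ℚₚ.*-zeroˡ (a _ · y))) ⟩
      sum (λ i → (a (e i) · y) * (a (e i) · y))         ≡⟨ sum-cong-≗ (λ i → cong₂ _*_ (a·y (e i)) (a·y (e i))) ⟩
      sum (λ i → (a′ i · z) * (a′ i · z))               ≤⟨ ∣az∣²≤d²∣z∣² (G [ S ]) a′ (λ i j → a² (e i) (e j)) Δ≤d (0<fromℕ d-1) z ⟩
      fromℕ (suc d-1) * fromℕ (suc d-1) * (z · z)       ∎)
    where
    open ℚₚ.≤-Reasoning

    X : Subset n
    X = tabulate (not ∘ colour)

    e : Fin Subset.∣ S ∣ → Fin n
    e = element S

    a′ : Fin Subset.∣ S ∣ → Fin Subset.∣ S ∣ → ℚ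
    a′ i j = a (e i) (e j)

    -- For u in X ∩ S the equation is y u = 0, and for u in X outside S it is (a y) u = 0. A vertex
    -- outside both X and S costs no equation: its neighbours lie in X, where y vanishes.
    row : Fin n → Vector ℚ Subset.∣ S ∣
    row u with u Subsetₚ.∈? S
    ... | yes _ = λ j → [ does (e j Finₚ.≟ u) ]ᵇ
    ... | no _  = λ j → a u (e j)

    solution = kernel Subset.∣ X ∣ Subset.∣ S ∣ (List.tabulate (row ∘ element X)) (Listₚ.length-tabulate (row ∘ element X)) ∣X∣<∣S∣

    z : Vector ℚ Subset.∣ S ∣
    z = proj₁ solution

    y : Vector ℚ n
    y = extend S z

    0<z·z : 0ℚ < z · z
    0<z·z = let j , zj≢0 = proj₁ (proj₂ solution) in 0<∑ (λ i → 0≤p*p (z i)) j (0<p*p (z j) zj≢0)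

    equation : ∀ u → colour u ≡ false → row u · z ≡ 0ℚ
    equation u e with element-surjective X {u} (∈-tabulate (cong not e))
    ... | t , refl = Allₚ.tabulate⁻ (proj₂ (proj₂ solution)) t

    a·y : ∀ u → a u · y ≡ (λ j → a u (e j)) · z
    a·y u = trans (∑-element S (λ {v} v∉ → trans (cong (a u v *_) (extend-∉ S z v∉)) (ℚₚ.*-zeroʳ (a u v))))
                  (sum-cong-≗ (λ j → cong (a u (e j) *_) (extend-element S z j)))

    y·y : y · y ≡ z · z
    y·y = trans (∑-element S (λ {v} v∉ → trans (cong (_* y v) (extend-∉ S z v∉)) (ℚₚ.*-zeroˡ (y v))))
                (sum-cong-≗ (λ j → cong₂ _*_ (extend-element S z j) (extend-element S z j)))

    y-false : ∀ u → colour u ≡ false → y u ≡ 0ℚ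
    y-false u cu with u Subsetₚ.∈? S | equation u cu
    ... | no  u∉ | _  = extend-∉ S z u∉
    ... | yes u∈ | eq with element-surjective S u∈
    ... | i , refl = trans (extend-element S z i) (trans (sym indicator) eq)
      where
      indicator : sum (λ j → [ does (e j Finₚ.≟ e i) ]ᵇ * z j) ≡ z i
      indicator = trans (∑-single i off) on
        where
        off : ∀ j → j ≢ i → [ does (e j Finₚ.≟ e i) ]ᵇ * z j ≡ 0ℚ
        off j j≢i with e j Finₚ.≟ e i
        ... | yes q = contradiction (element-injective S q) j≢i
        ... | no _  = ℚₚ.*-zeroˡ (z j)
        on : [ does (e i Finₚ.≟ e i) ]ᵇ * z i ≡ z i
        on with e i Finₚ.≟ e i
        ... | yes _ = ℚₚ.*-identityˡ (z i)
        ... | no ¬q = contradiction refl ¬q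

    a≡0 : ∀ u v → ¬ Adj G u v → a u v ≡ 0ℚ
    a≡0 u v ¬uv with a u v ℚₚ.≟ 0ℚ | adj? G u v | a² u v
    ... | yes e | _      | _  = e
    ... | no ¬e | yes uv | _  = contradiction uv ¬uv
    ... | no ¬e | no _   | eq = cancel-≡0 (a u v) ¬e eq

    colour-false : ∀ {b c} → b ≡ true → b ≢ c → c ≡ false
    colour-false {c = false} _ _ = refl
    colour-false {c = true}  refl ne = contradiction refl ne

    ay-∉ : ∀ {u} → u ∉ S → a u · y ≡ 0ℚ
    ay-∉ {u} u∉ with colour u in cu
    ... | true = ∑-0 term
      where
      term : ∀ v → a u v * y v ≡ 0ℚ
      term v with adj? G u v
      ... | yes uv = trans (cong (a u v *_) (y-false v (colour-false cu (proper u v uv)))) (ℚₚ.*-zeroʳ (a u v))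
      ... | no ¬uv = trans (cong (_* y v) (a≡0 u v ¬uv)) (ℚₚ.*-zeroˡ (y v))
    ... | false with u Subsetₚ.∈? S | equation u cu
    ...   | yes u∈ | _  = contradiction u∈ u∉
    ...   | no _   | eq = trans (a·y u) eq

  -- Signed adjacency matrices of products

  δ : ∀ {n} → Fin n → Fin n → ℚ
  δ i j = [ does (i Finₚ.≟ j) ]ᵇ

  δ-refl : ∀ {n} (i : Fin n) → δ i i ≡ 1ℚ
  δ-refl i with i Finₚ.≟ i
  ... | yes _ = refl
  ... | no ¬e = contradiction refl ¬e

  δ-≢ : ∀ {n} {i j : Fin n} → i ≢ j → δ i j ≡ 0ℚ
  δ-≢ {i = i} {j} i≢j with i Finₚ.≟ j
  ... | yes e = contradiction e i≢j
  ... | no _  = refl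

  δ-sym : ∀ {n} (i j : Fin n) → δ i j ≡ δ j i
  δ-sym i j with i Finₚ.≟ j
  ... | yes refl = sym (δ-refl i)
  ... | no i≢j   = sym (δ-≢ (i≢j ∘ sym))

  ∑-δ : ∀ {n} i (F : Fin n → ℚ) → sum (λ j → δ i j * F j) ≡ F i
  ∑-δ i F = trans (∑-single i (λ j j≢i → trans (cong (_* F j) (δ-≢ (j≢i ∘ sym))) (ℚₚ.*-zeroˡ (F j))))
                  (trans (cong (_* F i) (δ-refl i)) (ℚₚ.*-identityˡ (F i)))

  IsSigned : ∀ {n} → Graph n → (Fin n → Fin n → ℚ) → Set
  IsSigned G a = (∀ u v → a u v * a u v ≡ [ does (adj? G u v) ]ᵇ) × (∀ u v → a u v ≡ a v u)

  -- The inequality diag w ≤ aᵀ a of quadratic forms. Such bounds add up over the factors of a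
  -- product. Weights, rather than one constant, leave room for singular matrices such as that of
  -- the path on 3 vertices.
  FormBound : ∀ {n} → (Fin n → ℚ) → (Fin n → Fin n → ℚ) → Set
  FormBound w a = ∀ z → sum (λ u → w u * (z u * z u)) ≤ sum (λ u → (a u · z) * (a u · z))

  q*q≡0⇒q≡0 : ∀ q → q * q ≡ 0ℚ → q ≡ 0ℚ
  q*q≡0⇒q≡0 q e with q ℚₚ.≟ 0ℚ
  ... | yes q≡0 = q≡0
  ... | no  q≢0 = cancel-≡0 q q≢0 e

  module Product {m n} (P : Graph m) (G : Graph n)
    (p : Fin m → Fin m → ℚ) (a : Fin n → Fin n → ℚ) (s : Fin m → ℚ)
    (p-signed : IsSigned P p) (a-signed : IsSigned G a)
    (s² : ∀ i → s i * s i ≡ 1ℚ) (s-alternates : ∀ i j → p i j * s j ≡ - (p i j * s i)) where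

    private
      -- The matrix p ⊗ 1 + s ⊗ a, with s read as a diagonal matrix of signs. The hypothesis
      -- `s-alternates` says that s anticommutes with p.
      entry : Fin m × Fin n → Fin m × Fin n → ℚ
      entry (i , x) (j , x′) = p i j * δ x x′ + s i * δ i j * a x x′

    product : Fin (m ℕ.* n) → Fin (m ℕ.* n) → ℚ
    product u v = entry (remQuot n u) (remQuot n v)

    product-signed : IsSigned (P □ G) product
    product-signed = (λ u v → square (remQuot n u) (remQuot n v)) , (λ u v → symmetric (remQuot n u) (remQuot n v))
      where
      diagonal : ∀ {l} (H : Graph l) {b} → IsSigned H b → ∀ i → b i i ≡ 0ℚ
      diagonal H b-signed i = q*q≡0⇒q≡0 _
        (trans (proj₁ b-signed i i) (cong [_]ᵇ (does-false (adj? H i i) (adj-irrefl H))))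

      square : ∀ α β → entry α β * entry α β ≡
        [ (does (proj₁ α Finₚ.≟ proj₁ β) ∧ does (adj? G (proj₂ α) (proj₂ β))) ∨
          (does (proj₂ α Finₚ.≟ proj₂ β) ∧ does (adj? P (proj₁ α) (proj₁ β))) ]ᵇ
      square (i , x) (j , x′) with i Finₚ.≟ j | x Finₚ.≟ x′
      ... | yes refl | yes refl
        rewrite diagonal P p-signed i | diagonal G a-signed x
              | does-false (adj? G x x) (adj-irrefl G) | does-false (adj? P i i) (adj-irrefl P) = eq (s i)
        where
        eq : ∀ s → (0ℚ * 1ℚ + s * 1ℚ * 0ℚ) * (0ℚ * 1ℚ + s * 1ℚ * 0ℚ) ≡ 0ℚ
        eq = solve-∀ ℚ-ring
      ... | yes refl | no _ = trans (eq (p i i) (s i) (a x x′)) (trans (cong (_* (a x x′ * a x x′)) (s² i))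
          (trans (ℚₚ.*-identityˡ _) (trans (proj₁ a-signed x x′) (cong [_]ᵇ (∨-false (does (adj? G x x′)))))))
        where
        ∨-false : ∀ b → b ≡ b ∨ false
        ∨-false true  = refl
        ∨-false false = refl
        eq : ∀ p s a → (p * 0ℚ + s * 1ℚ * a) * (p * 0ℚ + s * 1ℚ * a) ≡ (s * s) * (a * a)
        eq = solve-∀ ℚ-ring
      ... | no _ | yes refl = trans (eq (p i j) (s i) (a x x)) (proj₁ p-signed i j)
        where
        eq : ∀ p s a → (p * 1ℚ + s * 0ℚ * a) * (p * 1ℚ + s * 0ℚ * a) ≡ p * p
        eq = solve-∀ ℚ-ring
      ... | no _ | no _ = eq (p i j) (s i) (a x x′)
        where
        eq : ∀ p s a → (p * 0ℚ + s * 0ℚ * a) * (p * 0ℚ + s * 0ℚ * a) ≡ 0ℚ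
        eq = solve-∀ ℚ-ring

      symmetric : ∀ α β → entry α β ≡ entry β α
      symmetric (i , x) (j , x′) = cong₂ _+_ (cong₂ _*_ (proj₂ p-signed i j) (δ-sym x x′)) (cong₂ _*_ (sδ i j) (proj₂ a-signed x x′))
        where
        sδ : ∀ i j → s i * δ i j ≡ s j * δ j i
        sδ i j with i Finₚ.≟ j
        ... | yes refl = cong (s i *_) (sym (δ-refl i))
        ... | no i≢j   = trans (ℚₚ.*-zeroʳ (s i)) (sym (trans (cong (s j *_) (δ-≢ (i≢j ∘ sym))) (ℚₚ.*-zeroʳ (s j))))

    -- The square of the product matrix is the sum of the squares of the two
    -- factors: the mixed terms cancel because s changes sign along edges of P.
    product-bound : ∀ {w W} → FormBound w p → FormBound W a →
                    FormBound (λ u → w (proj₁ (remQuot {m} n u)) + W (proj₂ (remQuot {m} n u))) product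
    product-bound {w} {W} p-bound a-bound y = begin
      sum (λ u → (w (proj₁ (remQuot {m} n u)) + W (proj₂ (remQuot {m} n u))) * (y u * y u))
        ≡⟨ trans (∑-combine m _) (sum-cong-≗ λ i → sum-cong-≗ λ x →
             cong (λ q → (w (proj₁ q) + W (proj₂ q)) * (Y i x * Y i x)) (Finₚ.remQuot-combine {m} i x)) ⟩
      sum (λ i → sum (λ x → (w i + W x) * (Y i x * Y i x)))
        ≡⟨ ∑∑-+ (λ i x → w i * (Y i x * Y i x)) (λ i x → W x * (Y i x * Y i x)) (λ i x → ℚₚ.*-distribʳ-+ (Y i x * Y i x) (w i) (W x)) ⟩
      sum (λ i → sum (λ x → w i * (Y i x * Y i x))) + sum (λ i → sum (λ x → W x * (Y i x * Y i x)))
        ≡⟨ cong (_+ sum (λ i → sum (λ x → W x * (Y i x * Y i x)))) (∑-comm (λ i x → w i * (Y i x * Y i x))) ⟩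
      sum (λ x → sum (λ i → w i * (Y i x * Y i x))) + sum (λ i → sum (λ x → W x * (Y i x * Y i x)))
        ≤⟨ ℚₚ.+-mono-≤ (∑-mono λ x → p-bound (λ i → Y i x)) (∑-mono λ i → a-bound (Y i)) ⟩
      sum (λ x → sum (λ i → R i x * R i x)) + sum (λ i → sum (λ x → T i x * T i x))
        ≡⟨ cong (_+ sum (λ i → sum (λ x → T i x * T i x))) (∑-comm (λ i x → R i x * R i x)) ⟨
      sum (λ i → sum (λ x → R i x * R i x)) + sum (λ i → sum (λ x → T i x * T i x))
        ≡⟨ ∑∑-+ (λ i x → R i x * R i x) (λ i x → T i x * T i x) (λ _ _ → refl) ⟨
      sum (λ i → sum (λ x → R i x * R i x + T i x * T i x))
        ≡⟨ trans (cong (sum (λ i → sum (λ x → R i x * R i x + T i x * T i x)) +_) cross≡0) (ℚₚ.+-identityʳ _) ⟨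
      sum (λ i → sum (λ x → R i x * R i x + T i x * T i x)) + sum (λ i → sum (λ x → 2ℚ * (s i * R i x * T i x)))
        ≡⟨ ∑∑-+ (λ i x → R i x * R i x + T i x * T i x) (λ i x → 2ℚ * (s i * R i x * T i x)) square ⟨
      sum (λ i → sum (λ x → (R i x + s i * T i x) * (R i x + s i * T i x)))
        ≡⟨ trans (∑-combine m _) (sum-cong-≗ λ i → sum-cong-≗ λ x → cong₂ _*_ (apply i x) (apply i x)) ⟨
      sum (λ u → (product u · y) * (product u · y)) ∎
      where
      open ℚₚ.≤-Reasoning

      Y : Fin m → Fin n → ℚ
      Y i x = y (combine i x)

      R T : Fin m → Fin n → ℚ
      R i x = sum (λ j → p i j * Y j x)
      T i x = sum (λ x′ → a x x′ * Y i x′)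

      ∑∑-+ : ∀ {H : Fin m → Fin n → ℚ} (E F : Fin m → Fin n → ℚ) → (∀ i x → H i x ≡ E i x + F i x) →
             sum (λ i → sum (H i)) ≡ sum (λ i → sum (E i)) + sum (λ i → sum (F i))
      ∑∑-+ E F h = trans (sum-cong-≗ (λ i → trans (sum-cong-≗ (h i)) (∑-distrib-+ (E i) (F i))))
                         (∑-distrib-+ (λ i → sum (E i)) (λ i → sum (F i)))

      apply : ∀ i x → product (combine i x) · y ≡ R i x + s i * T i x
      apply i x = begin-equality
        product (combine i x) · y
          ≡⟨ ∑-combine m _ ⟩
        sum (λ j → sum (λ x′ → product (combine i x) (combine j x′) * Y j x′))
          ≡⟨ sum-cong-≗ (λ j → trans (sum-cong-≗ (λ x′ → trans
               (cong₂ (λ α β → entry α β * Y j x′) (Finₚ.remQuot-combine {m} i x) (Finₚ.remQuot-combine {m} j x′))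
               (eq (p i j) (δ x x′) (s i) (δ i j) (a x x′) (Y j x′))))
               (trans (∑-distrib-+ (λ x′ → δ x x′ * (p i j * Y j x′)) (λ x′ → δ i j * (s i * (a x x′ * Y j x′))))
                 (cong₂ _+_ (∑-δ x (λ x′ → p i j * Y j x′))
                   (trans (∑-*ˡ (δ i j) (λ x′ → s i * (a x x′ * Y j x′))) (cong (δ i j *_) (∑-*ˡ (s i) (λ x′ → a x x′ * Y j x′))))))) ⟩
        sum (λ j → p i j * Y j x + δ i j * (s i * T j x))
          ≡⟨ trans (∑-distrib-+ (λ j → p i j * Y j x) (λ j → δ i j * (s i * T j x)))
               (cong (R i x +_) (∑-δ i (λ j → s i * T j x))) ⟩
        R i x + s i * T i x ∎
        where
        eq : ∀ p d s e a y → (p * d + s * e * a) * y ≡ d * (p * y) + e * (s * (a * y))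
        eq = solve-∀ ℚ-ring

      square : ∀ i x → (R i x + s i * T i x) * (R i x + s i * T i x) ≡
               (R i x * R i x + T i x * T i x) + 2ℚ * (s i * R i x * T i x)
      square i x = trans (eq (R i x) (s i) (T i x))
        (cong (λ q → (R i x * R i x + q * (T i x * T i x)) + 2ℚ * (s i * R i x * T i x)) (s² i) ⟨ trans ⟩
         cong (λ q → (R i x * R i x + q) + 2ℚ * (s i * R i x * T i x)) (ℚₚ.*-identityˡ (T i x * T i x)))
        where
        eq : ∀ r s t → (r + s * t) * (r + s * t) ≡ (r * r + (s * s) * (t * t)) + (1ℚ + 1ℚ) * (s * r * t)
        eq = solve-∀ ℚ-ring

      Γ : Fin m → Fin m → ℚ
      Γ i j = sum (λ x → Y i x * T j x)

      Γ-sym : ∀ i j → Γ i j ≡ Γ j i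
      Γ-sym i j = begin-equality
        sum (λ x → Y i x * T j x)                            ≡⟨ sum-cong-≗ (λ x → sym (∑-*ˡ (Y i x) (λ x′ → a x x′ * Y j x′))) ⟩
        sum (λ x → sum (λ x′ → Y i x * (a x x′ * Y j x′)))   ≡⟨ ∑-comm (λ x x′ → Y i x * (a x x′ * Y j x′)) ⟩
        sum (λ x′ → sum (λ x → Y i x * (a x x′ * Y j x′)))   ≡⟨ sum-cong-≗ (λ x′ → trans (sum-cong-≗ (λ x →
                                                                  trans (cong (λ q → Y i x * (q * Y j x′)) (proj₂ a-signed x x′)) (eq (Y i x) (a x′ x) (Y j x′))))
                                                                  (∑-*ˡ (Y j x′) (λ x → a x′ x * Y i x))) ⟩
        sum (λ x → Y j x * T i x)                            ∎
        where
        eq : ∀ b c d → b * (c * d) ≡ d * (c * b)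
        eq = solve-∀ ℚ-ring

      -- The mixed terms add up to twice the sum of all c i j. Both p and Γ are symmetric, the
      -- latter because a is, and s changes sign along p; hence c is antisymmetric and its total is
      -- its own negative.
      c : Fin m → Fin m → ℚ
      c i j = p i j * s i * Γ j i

      c-antisym : ∀ i j → c j i ≡ - 1ℚ * c i j
      c-antisym i j = trans (cong₂ (λ q r → q * s j * r) (proj₂ p-signed j i) (Γ-sym i j))
        (trans (cong (_* Γ j i) (s-alternates i j)) (eq (p i j * s i) (Γ j i)))
        where
        eq : ∀ b c → - b * c ≡ - 1ℚ * (b * c)
        eq = solve-∀ ℚ-ring

      cross : ∀ i → sum (λ x → 2ℚ * (s i * R i x * T i x)) ≡ 2ℚ * sum (c i)
      cross i = trans (∑-*ˡ 2ℚ (λ x → s i * R i x * T i x)) (cong (2ℚ *_) (begin-equality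
        sum (λ x → s i * R i x * T i x)
          ≡⟨ sum-cong-≗ (λ x → trans (eq₁ (s i) (R i x) (T i x)) (*-distribʳ-sum (s i * T i x) (λ j → p i j * Y j x))) ⟩
        sum (λ x → sum (λ j → p i j * Y j x * (s i * T i x)))
          ≡⟨ ∑-comm (λ x j → p i j * Y j x * (s i * T i x)) ⟩
        sum (λ j → sum (λ x → p i j * Y j x * (s i * T i x)))
          ≡⟨ sum-cong-≗ (λ j → trans (sum-cong-≗ (λ x → eq₂ (p i j) (Y j x) (s i) (T i x))) (∑-*ˡ (p i j * s i) (λ x → Y j x * T i x))) ⟩
        sum (c i) ∎))
        where
        eq₁ : ∀ s r t → s * r * t ≡ r * (s * t)
        eq₁ = solve-∀ ℚ-ring
        eq₂ : ∀ p y s t → p * y * (s * t) ≡ (p * s) * (y * t)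
        eq₂ = solve-∀ ℚ-ring

      cross≡0 : sum (λ i → sum (λ x → 2ℚ * (s i * R i x * T i x))) ≡ 0ℚ
      cross≡0 = trans (trans (sum-cong-≗ cross) (∑-*ˡ 2ℚ (λ i → sum (c i)))) (eq C self)
        where
        C : ℚ
        C = sum (λ i → sum (c i))
        self : C ≡ - 1ℚ * C
        self = trans (∑-comm c) (trans (sum-cong-≗ (λ j → trans (sum-cong-≗ (λ i → c-antisym j i)) (∑-*ˡ (- 1ℚ) (c j))))
                                       (∑-*ˡ (- 1ℚ) (λ j → sum (c j))))
        eq : ∀ C → C ≡ - 1ℚ * C → 2ℚ * C ≡ 0ℚ
        eq C e = trans (eq₁ C) (trans (cong (C +_) e) (eq₂ C))
          where
          eq₁ : ∀ C → (1ℚ + 1ℚ) * C ≡ C + C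
          eq₁ = solve-∀ ℚ-ring
          eq₂ : ∀ C → C + - 1ℚ * C ≡ 0ℚ
          eq₂ = solve-∀ ℚ-ring

  -- Paths

  odd : ℕ → Bool
  odd zero    = false
  odd (suc n) = not (odd n)

  adjacency-signed : ∀ {n} (G : Graph n) → IsSigned G (adjacency G)
  adjacency-signed G = (λ i j → square (does (adj? G i j))) , adjacency-sym G
    where
    square : ∀ b → [ b ]ᵇ * [ b ]ᵇ ≡ [ b ]ᵇ
    square true  = ℚₚ.*-identityˡ 1ℚ
    square false = ℚₚ.*-zeroˡ 0ℚ

  path-odd : ∀ {m} {i j : Fin m} → Adj (Path m) i j → odd (toℕ j) ≡ not (odd (toℕ i))
  path-odd (inj₁ e) = cong odd e
  path-odd {i = i} {j} (inj₂ e) = trans (not-involutive (odd (toℕ j))) (cong not (cong odd (sym e)))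
    where
    not-involutive : ∀ b → b ≡ not (not b)
    not-involutive true  = refl
    not-involutive false = refl

  signᵇ : Bool → ℚ
  signᵇ true  = - 1ℚ
  signᵇ false = 1ℚ

  signᵇ-not : ∀ b → signᵇ (not b) ≡ - signᵇ b
  signᵇ-not true  = refl
  signᵇ-not false = refl

  signᵇ² : ∀ b → signᵇ b * signᵇ b ≡ 1ℚ
  signᵇ² true  = refl
  signᵇ² false = refl

  sign : ∀ {m} → Fin m → ℚ
  sign i = signᵇ (odd (toℕ i))

  sign-alternates : ∀ {m} (i j : Fin m) → adjacency (Path m) i j * sign j ≡ - (adjacency (Path m) i j * sign i)
  sign-alternates {m} i j = on-edges (adj? (Path m) i j) λ ij → trans (cong signᵇ (path-odd {i = i} {j} ij)) (signᵇ-not (odd (toℕ i)))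
    where
    on-edges : ∀ {A : Set} (A? : Dec A) {x y} → (A → x ≡ - y) → [ does A? ]ᵇ * x ≡ - ([ does A? ]ᵇ * y)
    on-edges (yes ij) {x} {y} h = trans (cong (1ℚ *_) (h ij)) (sym (ℚₚ.neg-distribʳ-* 1ℚ y))
    on-edges (no _)   {x} {y} h = trans (ℚₚ.*-zeroˡ x) (cong -_ (sym (ℚₚ.*-zeroˡ y)))

  first : ∀ {m} → Vector ℚ m → ℚ
  first {zero}  z = 0ℚ
  first {suc m} z = z zero

  -- ∑ᵢ (zᵢ₋₁ + zᵢ₊₁)² over a path whose vertex −1 carries the value c.
  pathForm : ∀ m → ℚ → Vector ℚ m → ℚ
  pathForm zero    c z = 0ℚ
  pathForm (suc m) c z = (first (z ∘ suc) + c) * (first (z ∘ suc) + c) + pathForm m (z zero) (z ∘ suc)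

  -- The boundary value c closes the induction: deleting vertex 0 leaves a shorter path in which z₀
  -- takes over the role of c.
  ∑≡pathForm : ∀ m c (z : Vector ℚ m) →
    let row = λ i → (adjacency (Path m) i · z) + [ toℕ i ℕ.≡ᵇ 0 ]ᵇ * c in
    sum (λ i → row i * row i) ≡ pathForm m c z
  ∑≡pathForm zero    c z = refl
  ∑≡pathForm (suc m) c z = cong₂ _+_ (cong (λ q → q * q) row-zero) (trans (sum-cong-≗ (λ i → cong (λ q → q * q) (row-suc i))) (∑≡pathForm m (z zero) (z ∘ suc)))
    where
    first≡ : ∀ m (z : Vector ℚ m) → sum (λ j → [ (toℕ j ℕ.≡ᵇ 0) ∨ false ]ᵇ * z j) ≡ first z
    first≡ zero    z = refl
    first≡ (suc m) z = trans (cong₂ _+_ (ℚₚ.*-identityˡ (z zero)) (∑-0 (λ j → ℚₚ.*-zeroˡ (z (suc j))))) (ℚₚ.+-identityʳ (z zero))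
    row-zero : adjacency (Path (suc m)) zero · z + 1ℚ * c ≡ first (z ∘ suc) + c
    row-zero = cong₂ _+_ (trans (cong₂ _+_ (ℚₚ.*-zeroˡ (z zero)) (first≡ m (z ∘ suc))) (ℚₚ.+-identityˡ (first (z ∘ suc)))) (ℚₚ.*-identityˡ c)
    row-suc : ∀ i → adjacency (Path (suc m)) (suc i) · z + 0ℚ * c ≡ adjacency (Path m) i · (z ∘ suc) + [ toℕ i ℕ.≡ᵇ 0 ]ᵇ * z zero
    row-suc i = eq ([ toℕ i ℕ.≡ᵇ 0 ]ᵇ) (z zero) (adjacency (Path m) i · (z ∘ suc)) c
      where
      eq : ∀ b x y c → b * x + y + 0ℚ * c ≡ y + b * x
      eq = solve-∀ ℚ-ring

  formBound-path : ∀ m {w} → (∀ z → sum (λ i → w i * (z i * z i)) ≤ pathForm m 0ℚ z) → FormBound w (adjacency (Path m))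
  formBound-path m h z = ℚₚ.≤-trans (h z) (ℚₚ.≤-reflexive (sym (trans
    (sum-cong-≗ (λ i → cong (λ q → q * q) (eq (adjacency (Path m) i · z) [ toℕ i ℕ.≡ᵇ 0 ]ᵇ))) (∑≡pathForm m 0ℚ z))))
    where
    eq : ∀ x b → x ≡ x + b * 0ℚ
    eq = solve-∀ ℚ-ring

  weight₃ : Fin 3 → ℚ
  weight₃ i = if odd (toℕ i) then 2ℚ else 0ℚ

  -- Both end vertices see only the middle one, which gives 2 z₁². The row of the middle vertex is
  -- the remainder (z₀ + z₂)².
  formBound₃ : FormBound weight₃ (adjacency (Path 3))
  formBound₃ = formBound-path 3 {weight₃} λ z → ≤-by (0≤p*p (z (suc (suc zero)) + z zero)) (eq (z zero) (z (suc zero)) (z (suc (suc zero))))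
    where
    eq : ∀ x y t → (y + 0ℚ) * (y + 0ℚ) + ((t + x) * (t + x) + ((0ℚ + y) * (0ℚ + y) + 0ℚ)) ≡
         0ℚ * (x * x) + ((1ℚ + 1ℚ) * (y * y) + (0ℚ * (t * t) + 0ℚ)) + (t + x) * (t + x)
    eq = solve-∀ ℚ-ring

  -- The form equals s (t x + y)². It is the completed square of one elimination step with pivot t.
  0≤tx²+2xy+sy² : ∀ {t s} → 0ℚ ≤ s → t * s ≡ 1ℚ → ∀ x y → 0ℚ ≤ t * (x * x) + 2ℚ * x * y + s * (y * y)
  0≤tx²+2xy+sy² {t} {s} 0≤s ts≡1 x y = subst (0ℚ ≤_)
    (trans (eq₁ t s x y) (trans (cong (λ u → u * t * (x * x) + u * (2ℚ * x * y) + s * (y * y)) ts≡1) (eq₂ t s x y)))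
    (0≤* 0≤s (0≤p*p (t * x + y)))
    where
    eq₁ : ∀ t s x y → s * ((t * x + y) * (t * x + y)) ≡ (t * s) * t * (x * x) + (t * s) * ((1ℚ + 1ℚ) * x * y) + s * (y * y)
    eq₁ = solve-∀ ℚ-ring
    eq₂ : ∀ t s x y → 1ℚ * t * (x * x) + 1ℚ * ((1ℚ + 1ℚ) * x * y) + s * (y * y) ≡ t * (x * x) + (1ℚ + 1ℚ) * x * y + s * (y * y)
    eq₂ = solve-∀ ℚ-ring

  -- The two halves of a path on 2 n vertices are tridiagonal forms with diagonal
  -- (1, 2, …, 2); rⱼ are the pivots of their elimination shifted by q, and sⱼ
  -- the inverses of the pivots.  One half is eliminated from the left and the
  -- other one from the right.
  module _ (q : ℚ) (n : ℕ) (r s : ℕ → ℚ) (r₀ : r 0 ≡ 1ℚ)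
    (rs : ∀ {j} → j ℕ.≤ n → r j * s j ≡ 1ℚ) (0<r : ∀ {j} → j ℕ.≤ n → 0ℚ < r j)
    (r-suc : ∀ {j} → suc j ℕ.≤ n → r (suc j) ≡ 2ℚ - q - s j) where

    private
      0≤s : ∀ {j} → j ℕ.≤ n → 0ℚ ≤ s j
      0≤s j≤n = cancel-0≤ (0<r j≤n) (subst (0ℚ ≤_) (sym (rs j≤n)) 0≤1)

      s₀ : s 0 ≡ 1ℚ
      s₀ = trans (sym (ℚₚ.*-identityˡ (s 0))) (trans (cong (_* s 0) (sym r₀)) (rs z≤n))

    -- Here a and c are the values at the vertices -2 and -1. The half containing a is eliminated on
    -- the way down, and r j - 1 is what its earlier vertices leave on a². The half containing c is
    -- eliminated on the way back: its n′ later vertices leave at least (1 - s n′) c².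
    eliminate-path : ∀ n′ j → j ℕ.+ n′ ≡ n → ∀ a c (z : Vector ℚ (n′ ℕ.* 2)) →
      (1ℚ - s n′) * (c * c) + q * (z · z) ≤
      (r j - 1ℚ) * (a * a) + ((first z + a) * (first z + a) + pathForm (n′ ℕ.* 2) c z)
    eliminate-path zero j e a c z = ≤-by (0≤* (ℚₚ.<⇒≤ (0<r j≤n)) (0≤p*p a))
      (trans (eq (r j) a c q) (cong (λ t → (1ℚ - t) * (c * c) + q * 0ℚ + r j * (a * a)) (sym s₀)))
      where
      j≤n : j ℕ.≤ n
      j≤n = ℕₚ.≤-reflexive (trans (sym (ℕₚ.+-identityʳ j)) e)
      eq : ∀ r a c q → (r - 1ℚ) * (a * a) + ((0ℚ + a) * (0ℚ + a) + 0ℚ) ≡ (1ℚ - 1ℚ) * (c * c) + q * 0ℚ + r * (a * a)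
      eq = solve-∀ ℚ-ring
    eliminate-path (suc n′) j e a c z = begin
      (1ℚ - s (suc n′)) * (c * c) + q * (x * x + (y * y + Z))
        -- One square is completed in each half: a against x with pivot r j, and y against c with
        -- pivot r (suc n′).
        ≤⟨ ≤-by (0≤+ (0≤tx²+2xy+sy² {r j} (0≤s j≤n) (rs j≤n) a x) (0≤tx²+2xy+sy² {r (suc n′)} (0≤s n′<n) (rs n′<n) y c))
             (eq (r j) (s j) (r (suc n′)) (s (suc n′)) q a c x y Z) ⟩
      (r j - 1ℚ) * (a * a) + ((x + a) * (x + a) + ((y + c) * (y + c) + ((1ℚ - (1ℚ + 1ℚ - q - r (suc n′))) * (y * y) + q * Z - (1ℚ + 1ℚ - q - s j - 1ℚ) * (x * x))))
        ≡⟨ cong₂ (λ e₁ e₂ → (r j - 1ℚ) * (a * a) + ((x + a) * (x + a) + ((y + c) * (y + c) + ((1ℚ - e₁) * (y * y) + q * Z - (e₂ - 1ℚ) * (x * x)))))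
             s-prev (sym (r-suc (subst (suc j ℕ.≤_) e′ (ℕₚ.m≤m+n (suc j) n′)))) ⟩
      (r j - 1ℚ) * (a * a) + ((x + a) * (x + a) + ((y + c) * (y + c) + ((1ℚ - s n′) * (y * y) + q * Z - (r (suc j) - 1ℚ) * (x * x))))
        ≤⟨ ℚₚ.+-monoʳ-≤ ((r j - 1ℚ) * (a * a)) (ℚₚ.+-monoʳ-≤ ((x + a) * (x + a)) (ℚₚ.+-monoʳ-≤ ((y + c) * (y + c)) rest)) ⟩
      (r j - 1ℚ) * (a * a) + ((x + a) * (x + a) + ((y + c) * (y + c) + K)) ∎
      where
      open ℚₚ.≤-Reasoning
      e′ : suc j ℕ.+ n′ ≡ n
      e′ = trans (sym (ℕₚ.+-suc j n′)) e
      j≤n : j ℕ.≤ n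
      j≤n = subst (j ℕ.≤_) e (ℕₚ.m≤m+n j (suc n′))
      n′<n : suc n′ ℕ.≤ n
      n′<n = subst (suc n′ ℕ.≤_) e (ℕₚ.m≤n+m (suc n′) j)
      x = z zero
      y = z (suc zero)
      z′ : Vector ℚ (n′ ℕ.* 2)
      z′ k = z (suc (suc k))
      Z = z′ · z′
      K = (first z′ + x) * (first z′ + x) + pathForm (n′ ℕ.* 2) y z′
      s-prev : 1ℚ + 1ℚ - q - r (suc n′) ≡ s n′
      s-prev = trans (cong (λ t → 1ℚ + 1ℚ - q - t) (r-suc n′<n)) (eq₁ q (s n′))
        where
        eq₁ : ∀ q s → 1ℚ + 1ℚ - q - (1ℚ + 1ℚ - q - s) ≡ s
        eq₁ = solve-∀ ℚ-ring
      rest : (1ℚ - s n′) * (y * y) + q * Z - (r (suc j) - 1ℚ) * (x * x) ≤ K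
      rest = ≤-by (≤⇒0≤ (eliminate-path n′ (suc j) e′ x y z′)) (eq₁ ((1ℚ - s n′) * (y * y) + q * Z) ((r (suc j) - 1ℚ) * (x * x)) K)
        where
        eq₁ : ∀ l m k → k ≡ l - m + (m + k - l)
        eq₁ = solve-∀ ℚ-ring
      eq : ∀ r s r′ s′ q a c x y Z →
        (r - 1ℚ) * (a * a) + ((x + a) * (x + a) + ((y + c) * (y + c) + ((1ℚ - (1ℚ + 1ℚ - q - r′)) * (y * y) + q * Z - (1ℚ + 1ℚ - q - s - 1ℚ) * (x * x)))) ≡
        (1ℚ - s′) * (c * c) + q * (x * x + (y * y + Z)) + ((r * (a * a) + (1ℚ + 1ℚ) * a * x + s * (x * x)) + (r′ * (y * y) + (1ℚ + 1ℚ) * y * c + s′ * (c * c)))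
      eq = solve-∀ ℚ-ring

    pathForm-bound : 1 ℕ.≤ n → ∀ (z : Vector ℚ (n ℕ.* 2)) → q * (z · z) ≤ pathForm (n ℕ.* 2) 0ℚ z
    pathForm-bound = bound n refl
      where
      bound : ∀ n₁ → n₁ ≡ n → 1 ℕ.≤ n₁ → ∀ (z : Vector ℚ (n₁ ℕ.* 2)) → q * (z · z) ≤ pathForm (n₁ ℕ.* 2) 0ℚ z
      bound (suc n′) e _ z = begin
        q * (x * x + (y * y + Z))
          -- The remainder is r (suc n′) y², the last pivot of the half that is eliminated from the
          -- right.
          ≤⟨ ≤-by (0≤* (subst (0ℚ ≤_) (r-suc n′<n) (ℚₚ.<⇒≤ (0<r n′<n))) (0≤p*p y)) (eq₁ (s n′) q (x * x) y Z) ⟩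
        (y + 0ℚ) * (y + 0ℚ) + (q * (x * x) + ((1ℚ - s n′) * (y * y) + q * Z))
          ≤⟨ ℚₚ.+-monoʳ-≤ ((y + 0ℚ) * (y + 0ℚ)) (ℚₚ.+-monoʳ-≤ (q * (x * x)) (eliminate-path n′ 1 e x y z′)) ⟩
        (y + 0ℚ) * (y + 0ℚ) + (q * (x * x) + ((r 1 - 1ℚ) * (x * x) + K))
          ≡⟨ cong ((y + 0ℚ) * (y + 0ℚ) +_) (trans (cong (λ t → q * (x * x) + ((t - 1ℚ) * (x * x) + K)) r₁) (eq₂ q (x * x) K)) ⟩
        (y + 0ℚ) * (y + 0ℚ) + K ∎
        where
        open ℚₚ.≤-Reasoning
        n′<n : suc n′ ℕ.≤ n
        n′<n = ℕₚ.≤-reflexive e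
        x = z zero
        y = z (suc zero)
        z′ : Vector ℚ (n′ ℕ.* 2)
        z′ k = z (suc (suc k))
        Z = z′ · z′
        K = (first z′ + x) * (first z′ + x) + pathForm (n′ ℕ.* 2) y z′
        r₁ : r 1 ≡ 2ℚ - q - 1ℚ
        r₁ = trans (r-suc (ℕₚ.≤-trans (s≤s z≤n) n′<n)) (cong (λ t → 2ℚ - q - t) s₀)
        eq₁ : ∀ s q X y Z → (y + 0ℚ) * (y + 0ℚ) + (q * X + ((1ℚ - s) * (y * y) + q * Z)) ≡ q * (X + (y * y + Z)) + (1ℚ + 1ℚ - q - s) * (y * y)
        eq₁ = solve-∀ ℚ-ring
        eq₂ : ∀ q X K → q * X + ((1ℚ + 1ℚ - q - 1ℚ - 1ℚ) * X + K) ≡ K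
        eq₂ = solve-∀ ℚ-ring

  -- The polynomials

  -- h q (suc n) = (−1)ⁿ gₙ(q); the recurrence extended to h q 0 = 1 absorbs the
  -- special case of g₁.
  h : ℚ → ℕ → ℚ
  h q 0             = 1ℚ
  h q 1             = 1ℚ
  h q (suc (suc j)) = (2ℚ - q) * h q (suc j) - h q j

  -- `h q (suc j)` is the leading principal minor of size j of the tridiagonal matrix minus q, so
  -- this is Sylvester's criterion: q is below every eigenvalue. In contrast to a comparison with a
  -- real root it is decidable.
  BelowRoots : ℕ → ℚ → Set
  BelowRoots zero    q = ⊤
  BelowRoots (suc n) q = BelowRoots n q × 0ℚ < h q (suc (suc n))

  belowRoots? : ∀ n q → Dec (BelowRoots n q)
  belowRoots? zero    q = yes tt
  belowRoots? (suc n) q = belowRoots? n q ×-dec (0ℚ ℚₚ.<? h q (suc (suc n)))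

  0<h : ∀ {n q j} → BelowRoots n q → j ℕ.≤ suc n → 0ℚ < h q j
  0<h {zero}  {j = zero}        _ _ = 0<1
  0<h {zero}  {j = suc zero}    _ _ = 0<1
  0<h {zero}  {j = suc (suc _)} _ (s≤s ())
  0<h {suc n} (good , 0<hₙ) j≤n with ℕₚ.m≤n⇒m<n∨m≡n j≤n
  ... | inj₁ (s≤s j≤n′) = 0<h good j≤n′
  ... | inj₂ refl       = 0<hₙ

  -- An identity of Christoffel-Darboux type: passing from j to j + 1 adds (y - x) h x (j + 1) h y
  -- (j + 1), a product of nonnegative factors.
  0≤cross : ∀ {x y} → x ≤ y → ∀ {n} → BelowRoots n x → BelowRoots n y → ∀ j → j ℕ.≤ suc n →
            0ℚ ≤ h x (suc j) * h y j - h y (suc j) * h x j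
  0≤cross x≤y gx gy zero    _   = ℚₚ.≤-refl
  0≤cross {x} {y} x≤y gx gy (suc j) j<n = subst (0ℚ ≤_) (sym (eq x y (h x (suc j)) (h y (suc j)) (h x j) (h y j)))
    (0≤+ (0≤* (≤⇒0≤ x≤y) (0≤* (ℚₚ.<⇒≤ (0<h gx j<n)) (ℚₚ.<⇒≤ (0<h gy j<n)))) (0≤cross x≤y gx gy j (ℕₚ.<⇒≤ j<n)))
    where
    eq : ∀ x y a b c d → ((1ℚ + 1ℚ - x) * a - c) * b - ((1ℚ + 1ℚ - y) * b - d) * a ≡ (y - x) * (a * b) + (a * d - b * c)
    eq = solve-∀ ℚ-ring

  -- The two conclusions need each other. `0≤cross` compares quotients of consecutive values;
  -- together with monotonicity one level down it gives h y ≤ h x at the new level, and this yields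
  -- positivity at x.
  belowRoots-mono : ∀ {x y} → x ≤ y → ∀ n → BelowRoots n y → BelowRoots n x × (∀ {j} → j ℕ.≤ suc n → h y j ≤ h x j)
  belowRoots-mono x≤y zero gy = tt , λ { {zero} _ → ℚₚ.≤-refl ; {suc zero} _ → ℚₚ.≤-refl ; {suc (suc _)} (s≤s ()) }
  belowRoots-mono {x} {y} x≤y (suc n) (gy , 0<hy) = (gx , ℚₚ.<-≤-trans 0<hy hy≤hx) , le
    where
    gx = proj₁ (belowRoots-mono x≤y n gy)
    hy≤hx : h y (suc (suc n)) ≤ h x (suc (suc n))
    hy≤hx = ℚₚ.*-cancelʳ-≤-pos (h y (suc n)) {{ℚ.positive (0<h gy ℕₚ.≤-refl)}} (ℚₚ.≤-trans
      (ℚₚ.*-monoˡ-≤-nonNeg (h y (suc (suc n))) {{ℚ.nonNegative (ℚₚ.<⇒≤ 0<hy)}} (proj₂ (belowRoots-mono x≤y n gy) ℕₚ.≤-refl))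
      (≤-by (0≤cross x≤y gx gy (suc n) ℕₚ.≤-refl) (eq (h x (suc (suc n)) * h y (suc n)) (h y (suc (suc n)) * h x (suc n)))))
      where
      eq : ∀ a b → a ≡ b + (a - b)
      eq = solve-∀ ℚ-ring
    le : ∀ {j} → j ℕ.≤ suc (suc n) → h y j ≤ h x j
    le j≤n with ℕₚ.m≤n⇒m<n∨m≡n j≤n
    ... | inj₁ (s≤s j≤n′) = proj₂ (belowRoots-mono x≤y n gy) j≤n′
    ... | inj₂ refl       = hy≤hx

  -- By the recurrence, the drop from one value to the next grows by q h q (j + 1) at each step,
  -- starting from 0.
  h-decreasing : ∀ {n q} → 0ℚ ≤ q → BelowRoots n q → ∀ j → j ℕ.≤ suc n → h q (suc j) ≤ h q j
  h-decreasing 0≤q good zero _ = ℚₚ.≤-refl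
  h-decreasing {q = q} 0≤q good (suc j) j<n = ≤-by
    (0≤+ (≤⇒0≤ (h-decreasing 0≤q good j (ℕₚ.<⇒≤ j<n))) (0≤* 0≤q (ℚₚ.<⇒≤ (0<h good j<n)))) (eq q (h q (suc j)) (h q j))
    where
    eq : ∀ q a b → a ≡ ((1ℚ + 1ℚ - q) * a - b) + ((b - a) + q * a)
    eq = solve-∀ ℚ-ring

  h-antitone : ∀ {n q} → 0ℚ ≤ q → BelowRoots n q → ∀ i {j} → j ℕ.+ i ℕ.≤ suc (suc n) → h q (j ℕ.+ i) ≤ h q i
  h-antitone 0≤q good i {zero}  _   = ℚₚ.≤-refl
  h-antitone 0≤q good i {suc j} (s≤s j+i≤n) =
    ℚₚ.≤-trans (h-decreasing 0≤q good (j ℕ.+ i) j+i≤n) (h-antitone 0≤q good i {j} (ℕₚ.m≤n⇒m≤1+n j+i≤n))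

  h≤1 : ∀ {n q} → 0ℚ ≤ q → BelowRoots n q → ∀ j → j ℕ.≤ suc (suc n) → h q j ≤ 1ℚ
  h≤1 {q = q} 0≤q good j j≤n = subst (λ i → h q i ≤ 1ℚ) (ℕₚ.+-identityʳ j)
    (h-antitone 0≤q good 0 {j} (subst (ℕ._≤ _) (sym (ℕₚ.+-identityʳ j)) j≤n))

  2^ : ℕ → ℚ
  2^ zero    = 1ℚ
  2^ (suc j) = 2ℚ * 2^ j

  -- One step of the recurrence at most doubles the difference and adds at most (y - x) h y ≤ y - x,
  -- whence 2^j - 1. The index may go one beyond the range in which positivity at y is assumed, so a
  -- first nonpositive value is covered.
  h-lipschitz : ∀ {x y} → 0ℚ ≤ x → x ≤ y → ∀ {n} → BelowRoots n y → ∀ j → j ℕ.≤ suc (suc n) →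
                h x j - h y j ≤ (2^ j - 1ℚ) * (y - x)
  h-lipschitz {x} {y} 0≤x x≤y good zero _ = ≤-by ℚₚ.≤-refl (eq (y - x))
    where
    eq : ∀ d → (1ℚ - 1ℚ) * d ≡ (1ℚ - 1ℚ) + 0ℚ
    eq = solve-∀ ℚ-ring
  h-lipschitz {x} {y} 0≤x x≤y good (suc zero) _ = ≤-by (≤⇒0≤ x≤y) (eq (y - x))
    where
    eq : ∀ d → ((1ℚ + 1ℚ) * 1ℚ - 1ℚ) * d ≡ (1ℚ - 1ℚ) + d
    eq = solve-∀ ℚ-ring
  h-lipschitz {x} {y} 0≤x x≤y {n} good (suc (suc j)) (s≤s j<n) = ≤-by
    (0≤+ (0≤+ (0≤+ (0≤* 0≤2 (≤⇒0≤ (h-lipschitz 0≤x x≤y good (suc j) (ℕₚ.m≤n⇒m≤1+n j<n))))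
              (0≤* 0≤x (≤⇒0≤ (le (suc j) j<n))))
              (0≤* (≤⇒0≤ x≤y) (≤⇒0≤ (h≤1 (ℚₚ.≤-trans 0≤x x≤y) good (suc j) (ℕₚ.m≤n⇒m≤1+n j<n)))))
         (≤⇒0≤ (le j (ℕₚ.<⇒≤ j<n))))
    (eq x y (h x (suc j)) (h y (suc j)) (h x j) (h y j) (2^ (suc j)))
    where
    0≤2 : 0ℚ ≤ 2ℚ
    0≤2 = 0≤+ 0≤1 0≤1
    le : ∀ j → j ℕ.≤ suc n → h y j ≤ h x j
    le _ j≤n = proj₂ (belowRoots-mono x≤y n good) j≤n
    eq : ∀ x y a b c d w → ((1ℚ + 1ℚ) * w - 1ℚ) * (y - x) ≡
         ((1ℚ + 1ℚ - x) * a - c) - ((1ℚ + 1ℚ - y) * b - d)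
         + ((1ℚ + 1ℚ) * ((w - 1ℚ) * (y - x) - (a - b)) + x * (a - b) + (y - x) * (1ℚ - b) + (c - d))
    eq = solve-∀ ℚ-ring

  h-0 : ∀ j → h 0ℚ j ≡ 1ℚ
  h-0 0             = refl
  h-0 1             = refl
  h-0 (suc (suc j)) = cong₂ (λ a b → (2ℚ - 0ℚ) * a - b) (h-0 (suc j)) (h-0 j)

  belowRoots-0 : ∀ n → BelowRoots n 0ℚ
  belowRoots-0 zero    = tt
  belowRoots-0 (suc n) = belowRoots-0 n , subst (0ℚ <_) (sym (h-0 (suc (suc n)))) 0<1

  inverse : ∀ {p} → 0ℚ < p → ∃[ s ] 0ℚ < s × p * s ≡ 1ℚ
  inverse = scaled 0<1

  -- Isolates the first failure of positivity. The earlier values are still positive, as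
  -- `h-lipschitz` requires.
  ¬belowRoots⇒h≤0 : ∀ n {q} → ¬ BelowRoots n q → ∃[ m ] m ℕ.< n × BelowRoots m q × h q (suc (suc m)) ≤ 0ℚ
  ¬belowRoots⇒h≤0 zero    ¬g = contradiction tt ¬g
  ¬belowRoots⇒h≤0 (suc n) {q} ¬g with belowRoots? n q
  ... | yes g = n , ℕₚ.≤-refl , g , ℚₚ.≮⇒≥ (λ 0<h → ¬g (g , 0<h))
  ... | no ¬g′ = let m , m<n , g , h≤0 = ¬belowRoots⇒h≤0 n ¬g′ in m , ℕₚ.m<n⇒m<1+n m<n , g , h≤0

  -- The pivots are the quotients of consecutive values of h.
  formBound-even : ∀ n {q} → 1 ℕ.≤ n → BelowRoots n q → FormBound (λ _ → q) (adjacency (Path (n ℕ.* 2)))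
  formBound-even n {q} 1≤n good = formBound-path (n ℕ.* 2) {λ _ → q} λ z →
    subst (_≤ pathForm (n ℕ.* 2) 0ℚ z) (sym (∑-*ˡ q (λ i → z i * z i)))
      (pathForm-bound q n r s (*-inv 0<1) rs 0<r r-suc 1≤n z)
    where
    -- The value 1 off the positive rationals makes r and s functions on all of ℕ.
    inv : ℚ → ℚ
    inv p with 0ℚ ℚₚ.<? p
    ... | yes 0<p = proj₁ (inverse 0<p)
    ... | no  _   = 1ℚ
    0<inv : ∀ p → 0ℚ < inv p
    0<inv p with 0ℚ ℚₚ.<? p
    ... | yes 0<p = proj₁ (proj₂ (inverse 0<p))
    ... | no  _   = 0<1
    *-inv : ∀ {p} → 0ℚ < p → p * inv p ≡ 1ℚ
    *-inv {p} 0<p with 0ℚ ℚₚ.<? p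
    ... | yes 0<p′ = proj₂ (proj₂ (inverse 0<p′))
    ... | no  ¬0<p = contradiction 0<p ¬0<p
    r s : ℕ → ℚ
    r j = h q (suc j) * inv (h q j)
    s j = h q j * inv (h q (suc j))
    rs : ∀ {j} → j ℕ.≤ n → r j * s j ≡ 1ℚ
    rs {j} j≤n = trans (eq (h q (suc j)) (inv (h q j)) (h q j) (inv (h q (suc j))))
      (cong₂ _*_ (*-inv (0<h good (s≤s j≤n))) (*-inv (0<h good (ℕₚ.m≤n⇒m≤1+n j≤n))))
      where
      eq : ∀ a b c d → (a * b) * (c * d) ≡ (a * d) * (c * b)
      eq = solve-∀ ℚ-ring
    0<r : ∀ {j} → j ℕ.≤ n → 0ℚ < r j
    0<r {j} j≤n = 0<* (0<h good (s≤s j≤n)) (0<inv (h q j))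
    r-suc : ∀ {j} → suc j ℕ.≤ n → r (suc j) ≡ 2ℚ - q - s j
    r-suc {j} j<n = trans (eq q (h q (suc j)) (inv (h q (suc j))) (h q j))
      (cong (λ t → (2ℚ - q) * t - s j) (*-inv (0<h good (ℕₚ.m≤n⇒m≤1+n j<n))) ⟨ trans ⟩ cong (_- s j) (ℚₚ.*-identityʳ (2ℚ - q)))
      where
      eq : ∀ q a b c → ((1ℚ + 1ℚ - q) * a - c) * b ≡ (1ℚ + 1ℚ - q) * (a * b) - c * b
      eq = solve-∀ ℚ-ring

  -- The smallest root, by bisection

  ½^ : ℕ → ℚ
  ½^ zero    = 1ℚ
  ½^ (suc i) = ½ * ½^ i

  0<½^ : ∀ i → 0ℚ < ½^ i
  0<½^ zero    = 0<1
  0<½^ (suc i) = half-pos (0<½^ i)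

  ½^-suc≤ : ∀ i → ½^ (suc i) ≤ ½^ i
  ½^-suc≤ i = ≤-by (ℚₚ.<⇒≤ (0<½^ (suc i))) (sym (halves (½^ i)))

  ½^-antitone : ∀ {i j} → i ℕ.≤′ j → ½^ j ≤ ½^ i
  ½^-antitone ℕ.≤′-refl              = ℚₚ.≤-refl
  ½^-antitone {j = suc j} (ℕ.≤′-step i≤j) = ℚₚ.≤-trans (½^-suc≤ j) (½^-antitone i≤j)

  2^*½^ : ∀ i → 2^ i * ½^ i ≡ 1ℚ
  2^*½^ zero    = ℚₚ.*-identityˡ 1ℚ
  2^*½^ (suc i) = trans (eq (2^ i) ½ (½^ i)) (cong (2ℚ * ½ *_) (2^*½^ i))
    where
    eq : ∀ a b c → (1ℚ + 1ℚ) * a * (b * c) ≡ ((1ℚ + 1ℚ) * b) * (a * c)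
    eq = solve-∀ ℚ-ring

  fromℕ<2^ : ∀ i → fromℕ i < 2^ i
  fromℕ<2^ zero    = 0<1
  fromℕ<2^ (suc i) = <-by (0<+ (<⇒0< (fromℕ<2^ i)) (≤⇒0≤ (1≤2^ i))) (eq (2^ i) (fromℕ i))
    where
    1≤2^ : ∀ i → 1ℚ ≤ 2^ i
    1≤2^ zero    = ℚₚ.≤-refl
    1≤2^ (suc i) = ≤-by (0≤+ (ℚₚ.≤-trans 0≤1 (1≤2^ i)) (≤⇒0≤ (1≤2^ i))) (eq′ (2^ i))
      where
      eq′ : ∀ w → (1ℚ + 1ℚ) * w ≡ 1ℚ + (w + (w - 1ℚ))
      eq′ = solve-∀ ℚ-ring
    eq : ∀ w f → (1ℚ + 1ℚ) * w ≡ 1ℚ + f + ((w - f) + (w - 1ℚ))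
    eq = solve-∀ ℚ-ring

  -- The numerator serves as the bound, because the denominator is at least 1.
  ≤fromℕ : ∀ p → 0ℚ < p → ∃[ n ] p ≤ fromℕ n
  ≤fromℕ p@(ℚ.mkℚ (ℤ.+ m) d _) _ = m , subst (p ≤_) (sym (fromℕ≡/1 m)) (ℚₚ.toℚᵘ-cancel-≤
    (ℚᵘₚ.≤-respʳ-≃ (ℚᵘₚ.≃-sym (ℚₚ.toℚᵘ-fromℚᵘ (mkℚᵘ (ℤ.+ m) 0))) (ℚᵘ.*≤* (ℤₚ.*-monoˡ-≤-nonNeg (ℤ.+ m) (ℤ.+≤+ (s≤s z≤n))))))
  ≤fromℕ (ℚ.mkℚ ℤ.-[1+ _ ] _ _) (ℚ.*<* ())

  ½^→0 : ∀ ε → 0ℚ < ε → ∃[ N ] ∀ i → N ℕ.≤ i → ½^ i < ε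
  ½^→0 ε 0<ε = N , λ i N≤i → ℚₚ.≤-<-trans (½^-antitone (ℕₚ.≤⇒≤′ N≤i)) ½^N<ε
    where
    s   = proj₁ (inverse 0<ε)
    0<s = proj₁ (proj₂ (inverse 0<ε))
    N   = proj₁ (≤fromℕ s 0<s)
    s<2^N : s < 2^ N
    s<2^N = ℚₚ.≤-<-trans (proj₂ (≤fromℕ s 0<s)) (fromℕ<2^ N)
    ½^N<ε : ½^ N < ε
    ½^N<ε = begin-strict
      ½^ N                 ≡⟨ ℚₚ.*-identityˡ (½^ N) ⟨
      1ℚ * ½^ N            ≡⟨ cong (_* ½^ N) (proj₂ (proj₂ (inverse 0<ε))) ⟨
      ε * s * ½^ N         ≡⟨ eq ε s (½^ N) ⟩
      ε * ½^ N * s         <⟨ ℚₚ.*-monoʳ-<-pos (ε * ½^ N) {{ℚ.positive (0<* 0<ε (0<½^ N))}} s<2^N ⟩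
      ε * ½^ N * 2^ N      ≡⟨ eq′ ε (½^ N) (2^ N) ⟩
      ε * (2^ N * ½^ N)    ≡⟨ cong (ε *_) (2^*½^ N) ⟩
      ε * 1ℚ               ≡⟨ ℚₚ.*-identityʳ ε ⟩
      ε                    ∎
      where
      open ℚₚ.≤-Reasoning
      eq : ∀ a b c → a * b * c ≡ a * c * b
      eq = solve-∀ ℚ-ring
      eq′ : ∀ a b c → a * b * c ≡ a * (c * b)
      eq′ = solve-∀ ℚ-ring

  ∣∣< : ∀ {p ε} → p < ε → - p < ε → ℚ.∣ p ∣ < ε
  ∣∣< {p} {ε} p<ε -p<ε with ℚₚ.∣p∣≡p∨∣p∣≡-p p
  ... | inj₁ e = subst (_< ε) (sym e) p<ε
  ... | inj₂ e = subst (_< ε) (sym e) -p<ε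

  p≤∣p∣ : ∀ p → p ≤ ℚ.∣ p ∣
  p≤∣p∣ p with ℚₚ.≤-total 0ℚ p
  ... | inj₁ 0≤p = ℚₚ.≤-reflexive (sym (ℚₚ.0≤p⇒∣p∣≡p 0≤p))
  ... | inj₂ p≤0 = ℚₚ.≤-trans p≤0 (ℚₚ.0≤∣p∣ p)

  module _ (n : ℕ) where

    -- The left end of an interval of length ½^i. For n ≥ 1 the left end always satisfies
    -- `BelowRoots` and the right end never does. The unit interval is a valid start: at 1, the root
    -- of g₁, the first condition `0 < h q 2` already fails.
    bisect : ℕ → ℚ
    bisect zero    = 0ℚ
    bisect (suc i) = if does (belowRoots? n (bisect i + ½^ (suc i))) then bisect i + ½^ (suc i) else bisect i

    bisect-below : ∀ i → BelowRoots n (bisect i)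
    bisect-below zero    = belowRoots-0 n
    bisect-below (suc i) with belowRoots? n (bisect i + ½^ (suc i))
    ... | yes g = g
    ... | no _  = bisect-below i

    bisect-above : 1 ℕ.≤ n → ∀ i → ¬ BelowRoots n (bisect i + ½^ i)
    bisect-above 1≤n zero    g = ℚₚ.<-irrefl refl (0<h {n} {j = 2} g (s≤s 1≤n))
    bisect-above 1≤n (suc i) with belowRoots? n (bisect i + ½^ (suc i))
    ... | yes _ = λ g → bisect-above 1≤n i (subst (BelowRoots n) (trans (ℚₚ.+-assoc (bisect i) _ _) (cong (bisect i +_) (halves (½^ i)))) g)
    ... | no ¬g = ¬g

    bisect-step : ∀ i → bisect i ≤ bisect (suc i) × bisect (suc i) + ½^ (suc i) ≤ bisect i + ½^ i
    bisect-step i with belowRoots? n (bisect i + ½^ (suc i))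
    ... | yes _ = ≤-by (ℚₚ.<⇒≤ (0<½^ (suc i))) refl ,
                  ℚₚ.≤-reflexive (trans (ℚₚ.+-assoc (bisect i) _ _) (cong (bisect i +_) (halves (½^ i))))
    ... | no _  = ℚₚ.≤-refl , ℚₚ.+-monoʳ-≤ (bisect i) (½^-suc≤ i)

    bisect-nested : ∀ {i j} → i ℕ.≤′ j → bisect i ≤ bisect j × bisect j + ½^ j ≤ bisect i + ½^ i
    bisect-nested ℕ.≤′-refl = ℚₚ.≤-refl , ℚₚ.≤-refl
    bisect-nested {j = suc j} (ℕ.≤′-step i≤j) =
      let l , u = bisect-nested i≤j ; l′ , u′ = bisect-step j in ℚₚ.≤-trans l l′ , ℚₚ.≤-trans u′ u

    0≤bisect : ∀ i → 0ℚ ≤ bisect i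
    0≤bisect i = proj₁ (bisect-nested (ℕₚ.≤⇒≤′ (z≤n {i})))

    bisect-cauchy : IsCauchy bisect
    bisect-cauchy ε 0<ε = N , λ i j N≤i N≤j → ∣∣< (close N≤i N≤j) (subst (_< ε) (eq (bisect i) (bisect j)) (close N≤j N≤i))
      where
      N = proj₁ (½^→0 ε 0<ε)
      eq : ∀ a b → b - a ≡ - (a - b)
      eq = solve-∀ ℚ-ring
      close : ∀ {i j} → N ℕ.≤ i → N ℕ.≤ j → bisect i - bisect j < ε
      close {i} {j} N≤i N≤j = ℚₚ.≤-<-trans
        (≤-by (0≤+ (0≤+ (≤⇒0≤ (proj₂ (bisect-nested (ℕₚ.≤⇒≤′ N≤i)))) (ℚₚ.<⇒≤ (0<½^ i))) (≤⇒0≤ (proj₁ (bisect-nested (ℕₚ.≤⇒≤′ N≤j)))))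
              (eq′ (bisect i) (½^ i) (bisect j) (bisect N) (½^ N)))
        (proj₂ (½^→0 ε 0<ε) N ℕₚ.≤-refl)
        where
        eq′ : ∀ a d b c e → e ≡ a - b + (((c + e - (a + d)) + d) + (b - c))
        eq′ = solve-∀ ℚ-ring

  β : ℕ → ℝ
  β n = mkℝ (bisect n) (bisect-cauchy n)

  -- Arithmetic on `ℝ` is termwise, so the real polynomial is evaluated at each rational approximant
  -- separately.
  seq-g : ∀ n x i → seq (g n x) i ≡ signᵇ (odd n) * h (seq x i) (suc n)
  seq-g 0 x i = sym (ℚₚ.*-identityˡ 1ℚ)
  seq-g 1 x i = eq (seq x i)
    where
    eq : ∀ q → q - 1ℚ ≡ - 1ℚ * ((1ℚ + 1ℚ - q) * 1ℚ - 1ℚ)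
    eq = solve-∀ ℚ-ring
  seq-g (suc (suc n)) x i = trans
    (cong₂ (λ u v → (q - 2ℚ) * u - v) (trans (seq-g (suc n) x i) (cong (_* h q (suc (suc n))) (signᵇ-not (odd n)))) (seq-g n x i))
    (trans (eq (signᵇ (odd n)) q (h q (suc (suc n))) (h q (suc n))) (cong (_* h q (suc (suc (suc n)))) (sym (trans (signᵇ-not (not (odd n))) (cong -_ (signᵇ-not (odd n)))))))
    where
    q = seq x i
    eq : ∀ s q a b → (q - (1ℚ + 1ℚ)) * (- s * a) - s * b ≡ - (- s) * ((1ℚ + 1ℚ - q) * a - b)
    eq = solve-∀ ℚ-ring

  ∣seq-g∣ : ∀ n x i → ℚ.∣ seq (g n x) i - seq 0ᴿ i ∣ ≡ ℚ.∣ h (seq x i) (suc n) ∣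
  ∣seq-g∣ n x i = trans (cong ℚ.∣_∣ (trans (ℚₚ.+-identityʳ (seq (g n x) i)) (seq-g n x i))) (abs (odd n))
    where
    abs : ∀ b {p} → ℚ.∣ signᵇ b * p ∣ ≡ ℚ.∣ p ∣
    abs true  {p} = trans (cong ℚ.∣_∣ (trans (sym (ℚₚ.neg-distribˡ-* 1ℚ p)) (cong -_ (ℚₚ.*-identityˡ p)))) (ℚₚ.∣-p∣≡∣p∣ p)
    abs false {p} = cong ℚ.∣_∣ (ℚₚ.*-identityˡ p)

  -- For q = ½^j the Lipschitz estimate from 0, where h is 1, gives h q j ≥ 1 - (2^j - 1) q = q > 0.
  belowRoots-½^ : ∀ n → BelowRoots n (½^ (suc n))
  belowRoots-½^ zero    = tt
  belowRoots-½^ (suc n) = good , 0<hₙ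
    where
    q = ½^ (suc (suc n))
    good : BelowRoots n q
    good = proj₁ (belowRoots-mono (½^-suc≤ (suc n)) n (belowRoots-½^ n))
    0≤q : 0ℚ ≤ q
    0≤q = ℚₚ.<⇒≤ (0<½^ (suc (suc n)))
    0<hₙ : 0ℚ < h q (suc (suc n))
    0<hₙ = ℚₚ.<-≤-trans (0<½^ (suc (suc n))) (≤-by (≤⇒0≤ (h-lipschitz ℚₚ.≤-refl 0≤q good (suc (suc n)) ℕₚ.≤-refl))
      (trans (eq₁ (h q (suc (suc n))) q) (cong₂ (λ u v → q + ((v - q) - (u - h q (suc (suc n))))) (sym (h-0 (suc (suc n)))) (sym (2^*½^ (suc (suc n)))))
        ⟨ trans ⟩ cong (λ t → q + (t - (h 0ℚ (suc (suc n)) - h q (suc (suc n))))) (eq₂ (2^ (suc (suc n))) q)))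
      where
      eq₁ : ∀ a q → a ≡ q + ((1ℚ - q) - (1ℚ - a))
      eq₁ = solve-∀ ℚ-ring
      eq₂ : ∀ w q → w * q - q ≡ (w - 1ℚ) * (q - 0ℚ)
      eq₂ = solve-∀ ℚ-ring

  2^-mono : ∀ {i j} → i ℕ.≤′ j → 2^ i ≤ 2^ j
  2^-mono ℕ.≤′-refl = ℚₚ.≤-refl
  2^-mono {i} {suc j} (ℕ.≤′-step i≤j) = ℚₚ.≤-trans (2^-mono i≤j)
    (≤-by (ℚₚ.≤-trans (0≤fromℕ j) (ℚₚ.<⇒≤ (fromℕ<2^ j))) (eq (2^ j)))
    where
    eq : ∀ w → (1ℚ + 1ℚ) * w ≡ w + w
    eq = solve-∀ ℚ-ring

  -- At the right end some h with index m + 2 ≤ n + 1 is nonpositive. The Lipschitz estimate makes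
  -- the same h small at the left end, and there h decreases in the index, so the value at n + 1 is
  -- small too.
  h-bisect≤ : ∀ n → 1 ℕ.≤ n → ∀ i → h (bisect n i) (suc n) ≤ 2^ (suc n) * ½^ i
  h-bisect≤ n 1≤n i with ¬belowRoots⇒h≤0 n (bisect-above n 1≤n i)
  ... | m , m<n , good , hb≤0 = begin
    h a (suc n)                                                ≡⟨ cong (h a) (sym (ℕₚ.m∸n+n≡m (s≤s m<n))) ⟩
    h a ((suc n ℕ.∸ suc (suc m)) ℕ.+ suc (suc m))              ≤⟨ h-antitone (0≤bisect n i) (bisect-below n i) (suc (suc m)) {suc n ℕ.∸ suc (suc m)}
                                                                   (ℕₚ.≤-trans (ℕₚ.≤-reflexive (ℕₚ.m∸n+n≡m (s≤s m<n))) (ℕₚ.n≤1+n (suc n))) ⟩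
    h a (suc (suc m))                                          ≤⟨ ≤-by (0≤+ (≤⇒0≤ lip) (0≤+ (≤⇒0≤ hb≤0) (ℚₚ.<⇒≤ (0<½^ i)))) (eq (2^ (suc (suc m))) (h a (suc (suc m))) (h (a + ½^ i) (suc (suc m))) a (½^ i)) ⟩
    2^ (suc (suc m)) * ½^ i                                    ≤⟨ ℚₚ.*-monoʳ-≤-nonNeg (½^ i) {{ℚ.nonNegative (ℚₚ.<⇒≤ (0<½^ i))}} (2^-mono (ℕₚ.≤⇒≤′ (s≤s m<n))) ⟩
    2^ (suc n) * ½^ i                                          ∎
    where
    open ℚₚ.≤-Reasoning
    a = bisect n i
    lip : h a (suc (suc m)) - h (a + ½^ i) (suc (suc m)) ≤ (2^ (suc (suc m)) - 1ℚ) * (a + ½^ i - a)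
    lip = h-lipschitz (0≤bisect n i) (≤-by (ℚₚ.<⇒≤ (0<½^ i)) refl) good (suc (suc m)) ℕₚ.≤-refl
    eq : ∀ w u v a d → w * d ≡ u + (((w - 1ℚ) * (a + d - a) - (u - v)) + ((0ℚ - v) + d))
    eq = solve-∀ ℚ-ring

  β-root : ∀ n → 1 ℕ.≤ n → g n (β n) ≃ 0ᴿ
  β-root n 1≤n ε 0<ε = proj₁ (½^→0 η 0<η) , λ i N≤i → begin-strict
    ℚ.∣ seq (g n (β n)) i - 0ℚ ∣   ≡⟨ ∣seq-g∣ n (β n) i ⟩
    ℚ.∣ h (bisect n i) (suc n) ∣   ≡⟨ ℚₚ.0≤p⇒∣p∣≡p (ℚₚ.<⇒≤ (0<h (bisect-below n i) ℕₚ.≤-refl)) ⟩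
    h (bisect n i) (suc n)         ≤⟨ h-bisect≤ n 1≤n i ⟩
    2^ (suc n) * ½^ i              <⟨ ℚₚ.*-monoʳ-<-pos (2^ (suc n)) {{ℚ.positive 0<2^}} (proj₂ (½^→0 η 0<η) i N≤i) ⟩
    2^ (suc n) * η                 ≡⟨ proj₂ (proj₂ (scaled 0<ε 0<2^)) ⟩
    ε                              ∎
    where
    open ℚₚ.≤-Reasoning
    0<2^ : 0ℚ < 2^ (suc n)
    0<2^ = ℚₚ.≤-<-trans (0≤fromℕ (suc n)) (fromℕ<2^ (suc n))
    η   = proj₁ (scaled 0<ε 0<2^)
    0<η = proj₁ (proj₂ (scaled 0<ε 0<2^))

  -- The right ends stay above ½^(n+1). From index n + 2 on, the length of the interval uses up at
  -- most half of that.
  β-positive : ∀ n → 1 ℕ.≤ n → 0ᴿ <ᴿ β n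
  β-positive n 1≤n = q′ , 0<½^ (suc (suc n)) , suc (suc n) , λ i n≤i →
    ℚₚ.≤-<-trans (ℚₚ.≤-reflexive (ℚₚ.+-identityˡ q′)) (<-by (0<+ (<⇒0< (q<b i)) (≤⇒0≤ (½^-antitone (ℕₚ.≤⇒≤′ n≤i))))
      (trans (eq (bisect n i) (½^ i) q′) (cong (λ t → q′ + ((bisect n i + ½^ i - t) + (q′ - ½^ i))) (halves (½^ (suc n))))))
    where
    q′ = ½^ (suc (suc n))
    q<b : ∀ i → ½^ (suc n) < bisect n i + ½^ i
    q<b i = ℚₚ.≰⇒> λ b≤q → bisect-above n 1≤n i (proj₁ (belowRoots-mono b≤q n (belowRoots-½^ n)))
    eq : ∀ a d q → a ≡ q + ((a + d - (q + q)) + (q - d))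
    eq = solve-∀ ℚ-ring

  -- If y were smaller, its late approximants would all lie below one fixed left end q. There h is
  -- some η > 0, and by monotonicity h is at least η at all those approximants, so gₙ(y) would stay
  -- away from 0.
  β-minimal : ∀ n y → g n y ≃ 0ᴿ → β n ≤ᴿ y
  β-minimal n y gy≃0 (ε , 0<ε , N , y+ε<β) = ℚₚ.<-irrefl refl (begin-strict
    η                                ≤⟨ proj₂ (belowRoots-mono (ℚₚ.<⇒≤ yⱼ<q) n good) ℕₚ.≤-refl ⟩
    h (seq y j) (suc n)              ≤⟨ p≤∣p∣ (h (seq y j) (suc n)) ⟩
    ℚ.∣ h (seq y j) (suc n) ∣        ≡⟨ ∣seq-g∣ n y j ⟨
    ℚ.∣ seq (g n y) j - 0ℚ ∣         <⟨ proj₂ (gy≃0 η 0<η) j (ℕₚ.m≤n⊔m K L) ⟩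
    η                                ∎)
    where
    open ℚₚ.≤-Reasoning
    M = proj₁ (cauchy y ε 0<ε)
    K = N ℕ.⊔ M
    q = bisect n K
    good : BelowRoots n q
    good = bisect-below n K
    η = h q (suc n)
    0<η : 0ℚ < η
    0<η = 0<h good ℕₚ.≤-refl
    L = proj₁ (gy≃0 η 0<η)
    j = K ℕ.⊔ L
    yⱼ<q : seq y j < q
    yⱼ<q = begin-strict
      seq y j                         ≡⟨ eq (seq y j) (seq y K) ⟩
      seq y K + (seq y j - seq y K)   ≤⟨ ℚₚ.+-monoʳ-≤ (seq y K) (p≤∣p∣ (seq y j - seq y K)) ⟩
      seq y K + ℚ.∣ seq y j - seq y K ∣ <⟨ ℚₚ.+-monoʳ-< (seq y K) (proj₂ (cauchy y ε 0<ε) j K (ℕₚ.≤-trans (ℕₚ.m≤n⊔m N M) (ℕₚ.m≤m⊔n K L)) (ℕₚ.m≤n⊔m N M)) ⟩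
      seq y K + ε                     <⟨ y+ε<β K (ℕₚ.m≤m⊔n N M) ⟩
      q                               ∎
      where
      eq : ∀ a b → a ≡ b + (a - b)
      eq = solve-∀ ℚ-ring

  β-minPositiveRoot : ∀ n → 1 ℕ.≤ n → IsMinPositiveRoot (g n) (β n)
  β-minPositiveRoot n 1≤n = (β-positive n 1≤n , β-root n 1≤n) , λ y (_ , gy≃0) → β-minimal n y gy≃0

  -- As g₁ is x - 1, the root equation is the claim itself.
  β₁≃1 : β 1 ≃ 1ᴿ
  β₁≃1 ε 0<ε = proj₁ root , λ i N≤i → subst (λ t → ℚ.∣ t ∣ < ε) (ℚₚ.+-identityʳ (bisect 1 i - 1ℚ)) (proj₂ root i N≤i)
    where root = β-root 1 ℕₚ.≤-refl ε 0<ε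

  -- Lower bounds

  b≢not-b : ∀ {b} → b ≢ not b
  b≢not-b {true}  ()
  b≢not-b {false} ()

  module _ (m : ℕ) where

    signedMatrix : ∀ k → ∃[ a ] IsSigned (Path m ^□ k) a
    signedMatrix zero    = (λ _ _ → 0ℚ) , (λ _ _ → refl) , λ _ _ → refl
    signedMatrix (suc k) = Step.product , Step.product-signed
      where module Step = Product (Path m) (Path m ^□ k) (adjacency (Path m)) (proj₁ (signedMatrix k)) sign
                            (adjacency-signed (Path m)) (proj₂ (signedMatrix k)) (λ i → signᵇ² (odd (toℕ i))) sign-alternates

    weight : (Fin m → ℚ) → ∀ k → Fin (m ℕ.^ k) → ℚ
    weight w zero    u = 0ℚ
    weight w (suc k) u = w (proj₁ (remQuot {m} (m ℕ.^ k) u)) + weight w k (proj₂ (remQuot {m} (m ℕ.^ k) u))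

    weight-bound : ∀ {w} → FormBound w (adjacency (Path m)) → ∀ k → FormBound (weight w k) (proj₁ (signedMatrix k))
    weight-bound bound zero    y = ℚₚ.≤-reflexive (eq (y zero))
      where
      eq : ∀ y → 0ℚ * (y * y) + 0ℚ ≡ (0ℚ * y + 0ℚ) * (0ℚ * y + 0ℚ) + 0ℚ
      eq = solve-∀ ℚ-ring
    weight-bound {w} bound (suc k) = Step.product-bound {w} {weight w k} bound (weight-bound {w} bound k)
      where module Step = Product (Path m) (Path m ^□ k) (adjacency (Path m)) (proj₁ (signedMatrix k)) sign
                            (adjacency-signed (Path m)) (proj₂ (signedMatrix k)) (λ i → signᵇ² (odd (toℕ i))) sign-alternates

    -- The parity of the coordinate sum. The origin gets false, so for odd m the class of false is
    -- the larger one.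
    colour : ∀ k → Fin (m ℕ.^ k) → Bool
    colour zero    u = false
    colour (suc k) u = odd (toℕ (proj₁ (remQuot {m} (m ℕ.^ k) u))) xor colour k (proj₂ (remQuot {m} (m ℕ.^ k) u))

    colour-proper : ∀ k {u v} → Adj (Path m ^□ k) u v → colour k v ≡ not (colour k u)
    colour-proper (suc k) {u} {v} adj = step (remQuot {m} (m ℕ.^ k) u) (remQuot {m} (m ℕ.^ k) v) adj
      where
      xor-notʳ : ∀ a b → a xor not b ≡ not (a xor b)
      xor-notʳ true  b = refl
      xor-notʳ false b = refl
      xor-notˡ : ∀ a b → not a xor b ≡ not (a xor b)
      xor-notˡ true  true  = refl
      xor-notˡ true  false = refl
      xor-notˡ false b     = refl
      step : ∀ α β → (proj₁ α ≡ proj₁ β × Adj (Path m ^□ k) (proj₂ α) (proj₂ β)) ⊎ (proj₂ α ≡ proj₂ β × Adj (Path m) (proj₁ α) (proj₁ β)) →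
             odd (toℕ (proj₁ β)) xor colour k (proj₂ β) ≡ not (odd (toℕ (proj₁ α)) xor colour k (proj₂ α))
      step (i , x) (j , x′) (inj₁ (refl , xx′)) = trans (cong (odd (toℕ i) xor_) (colour-proper k xx′)) (xor-notʳ (odd (toℕ i)) (colour k x))
      step (i , x) (j , x′) (inj₂ (refl , ij))  = trans (cong (_xor colour k x) (path-odd {i = i} {j} ij)) (xor-notˡ (odd (toℕ i)) (colour k x))

    -- The class of false is independent, hence smaller than S, and takes the part of X. The weights
    -- matter only on the other class, where y may be nonzero.
    Δ[]²≥ : ∀ {w} → FormBound w (adjacency (Path m)) → ∀ k c → (∀ u → colour k u ≡ true → c ≤ weight w k u) →
            ∀ S → Subset.∣ S ∣ ≡ suc (α (Path m ^□ k)) →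
            c ≤ fromℕ (Δ ((Path m ^□ k) [ S ])) * fromℕ (Δ ((Path m ^□ k) [ S ]))
    Δ[]²≥ {w} bound k c c≤w S ∣S∣≡1+α = spectral-bound G a (colour k) a²
      (λ u v uv e → b≢not-b (trans e (colour-proper k uv))) c form S
      (subst (Subset.∣ tabulate (not ∘ colour k) ∣ ℕ.<_) (sym ∣S∣≡1+α) (s≤s (∣I∣≤α G independent)))
      (Δ (G [ S ])) (Δ[]≥1 G S ∣S∣≡1+α) ℕₚ.≤-refl
      where
      G = Path m ^□ k
      a = proj₁ (signedMatrix k)
      a² = proj₁ (proj₂ (signedMatrix k))
      independent : Independent G (tabulate (not ∘ colour k))
      independent u v u∈ v∈ uv with trans (sym (∈-tabulate⁻ {b = not ∘ colour k} v∈)) (cong not (colour-proper k uv))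
      ... | eq with colour k u | ∈-tabulate⁻ {b = not ∘ colour k} u∈
      ... | false | _ = case eq of λ ()
      form : ∀ y → (∀ u → colour k u ≡ false → y u ≡ 0ℚ) → c * (y · y) ≤ sum (λ u → (a u · y) * (a u · y))
      form y y-false = ℚₚ.≤-trans (subst (_≤ sum (λ u → weight w k u * (y u * y u))) (∑-*ˡ c (λ u → y u * y u)) (∑-mono pointwise))
                                  (weight-bound {w} bound k y)
        where
        pointwise : ∀ u → c * (y u * y u) ≤ weight w k u * (y u * y u)
        pointwise u with colour k u in cu
        ... | true  = ℚₚ.*-monoʳ-≤-nonNeg (y u * y u) {{ℚ.nonNegative (0≤p*p (y u))}} (c≤w u cu)
        ... | false rewrite y-false u cu = ≤-by ℚₚ.≤-refl (eq (weight w k u) c)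
          where
          eq : ∀ a b → a * (0ℚ * 0ℚ) ≡ b * (0ℚ * 0ℚ) + 0ℚ
          eq = solve-∀ ℚ-ring

  -- Serves to check the default value m ^ k of `f` in the lower bounds.
  n<m^n : ∀ {m} → 2 ℕ.≤ m → ∀ n → n ℕ.< m ℕ.^ n
  n<m^n 2≤m zero    = ℕₚ.≤-refl
  n<m^n {m} 2≤m (suc n) = begin
    2 ℕ.+ n                   ≤⟨ s≤s (n<m^n 2≤m n) ⟩
    1 ℕ.+ m ℕ.^ n             ≤⟨ ℕₚ.+-monoˡ-≤ (m ℕ.^ n) (ℕₚ.≤-trans (s≤s z≤n) (n<m^n 2≤m n)) ⟩
    m ℕ.^ n ℕ.+ m ℕ.^ n       ≡⟨ cong (m ℕ.^ n ℕ.+_) (sym (ℕₚ.+-identityʳ (m ℕ.^ n))) ⟩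
    2 ℕ.* m ℕ.^ n             ≤⟨ ℕₚ.*-monoˡ-≤ (m ℕ.^ n) 2≤m ⟩
    m ℕ.* m ℕ.^ n             ∎
    where open ℕₚ.≤-Reasoning

  f²≥ : ∀ n {q} → 1 ℕ.≤ n → BelowRoots n q → ∀ k →
        fromℕ k * q ≤ fromℕ (f (Path (n ℕ.* 2) ^□ k)) * fromℕ (f (Path (n ℕ.* 2) ^□ k))
  f²≥ n {q} 1≤n good k = f-elim G (λ d → fromℕ k * q ≤ fromℕ d * fromℕ d) default
    (Δ[]²≥ (n ℕ.* 2) (formBound-even n 1≤n good) k (fromℕ k * q) (λ u _ → ℚₚ.≤-reflexive (sym (weight-const k u))))
    where
    G = Path (n ℕ.* 2) ^□ k
    N = (n ℕ.* 2) ℕ.^ k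
    weight-const : ∀ k u → weight (n ℕ.* 2) (λ _ → q) k u ≡ fromℕ k * q
    weight-const zero    u = sym (ℚₚ.*-zeroˡ q)
    weight-const (suc k) u = trans (cong (q +_) (weight-const k _)) (eq q (fromℕ k))
      where
      eq : ∀ q k → q + k * q ≡ (1ℚ + k) * q
      eq = solve-∀ ℚ-ring
    k<N : k ℕ.< N
    k<N = n<m^n (ℕₚ.*-monoˡ-≤ 2 1≤n) k
    0≤1-q : 0ℚ ≤ 1ℚ - q
    0≤1-q = subst (0ℚ ≤_) (eq q) (ℚₚ.<⇒≤ (0<h {n} {j = 2} good (s≤s 1≤n)))
      where
      eq : ∀ q → (1ℚ + 1ℚ - q) * 1ℚ - 1ℚ ≡ 1ℚ - q
      eq = solve-∀ ℚ-ring
    -- For the default value N of `f`: q < 1, because h q 2 = 1 - q is positive, and k < N ≤ N².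
    default : fromℕ k * q ≤ fromℕ N * fromℕ N
    default = begin
      fromℕ k * q         ≤⟨ ≤-by (0≤* (0≤fromℕ k) 0≤1-q) (eq (fromℕ k) q) ⟩
      fromℕ k             ≤⟨ fromℕ-mono-≤ (ℕₚ.≤-trans (ℕₚ.<⇒≤ k<N) (ℕₚ.m≤m*n N N {{ℕ.>-nonZero (ℕₚ.≤-<-trans z≤n k<N)}})) ⟩
      fromℕ (N ℕ.* N)     ≡⟨ fromℕ-* N N ⟩
      fromℕ N * fromℕ N   ∎
      where
      open ℚₚ.≤-Reasoning
      eq : ∀ k q → k ≡ k * q + k * (1ℚ - q)
      eq = solve-∀ ℚ-ring

  f[P₃^k]≥2 : ∀ k → 1 ℕ.≤ k → 2 ℕ.≤ f (Path 3 ^□ k)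
  f[P₃^k]≥2 k 1≤k = f-elim (Path 3 ^□ k) (2 ℕ.≤_) (ℕₚ.≤-trans (s≤s 1≤k) (n<m^n (s≤s (s≤s z≤n)) k))
    λ S e → 2≤d² (fromℕ-cancel-≤ (subst (fromℕ 2 ≤_) (sym (fromℕ-* (Δ ((Path 3 ^□ k) [ S ])) (Δ ((Path 3 ^□ k) [ S ]))))
      (Δ[]²≥ 3 formBound₃ k 2ℚ (heavy k) S e)))
    where
    2≤d² : ∀ {d} → 2 ℕ.≤ d ℕ.* d → 2 ℕ.≤ d
    2≤d² {suc zero}    (s≤s ())
    2≤d² {suc (suc d)} _ = s≤s (s≤s z≤n)
    0≤2 : 0ℚ ≤ 2ℚ
    0≤2 = 0≤+ 0≤1 0≤1
    0≤weight₃ : ∀ i → 0ℚ ≤ weight₃ i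
    0≤weight₃ i with odd (toℕ i)
    ... | true  = 0≤2
    ... | false = ℚₚ.≤-refl
    0≤weight : ∀ k u → 0ℚ ≤ weight 3 weight₃ k u
    0≤weight zero    u = ℚₚ.≤-refl
    0≤weight (suc k) u = 0≤+ (0≤weight₃ (proj₁ (remQuot {3} (3 ℕ.^ k) u))) (0≤weight k (proj₂ (remQuot {3} (3 ℕ.^ k) u)))
    -- An odd coordinate sum requires a coordinate equal to 1, the middle vertex, and that one
    -- already has weight 2.
    heavy : ∀ k u → colour 3 k u ≡ true → 2ℚ ≤ weight 3 weight₃ k u
    heavy (suc k) u = step (remQuot {3} (3 ℕ.^ k) u)
      where
      step : ∀ α → odd (toℕ (proj₁ α)) xor colour 3 k (proj₂ α) ≡ true → 2ℚ ≤ weight₃ (proj₁ α) + weight 3 weight₃ k (proj₂ α)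
      step (i , x) e with odd (toℕ i)
      ... | true  = ≤-by (0≤weight k x) refl
      ... | false = subst (2ℚ ≤_) (sym (ℚₚ.+-identityˡ (weight 3 weight₃ k x))) (heavy k x e)

  -- Upper bounds

  ∧-true⁻ : ∀ {a b} → a ∧ b ≡ true → a ≡ true × b ≡ true
  ∧-true⁻ {true} {true} _ = refl , refl

  []ᵇ≤ : ∀ {b q} → 0ℚ ≤ q → (b ≡ true → 1ℚ ≤ q) → [ b ]ᵇ ≤ q
  []ᵇ≤ {true}  _   h = h refl
  []ᵇ≤ {false} 0≤q _ = 0≤q

  -- Pairing up consecutive layers.
  pathSum-bound : ∀ m (c : Fin m → ℚ) M → 0ℚ ≤ M → (∀ i → 2ℚ * c i ≤ M + 1ℚ) →
    (∀ i j → toℕ j ≡ suc (toℕ i) → c i + c j ≤ M) → 2ℚ * sum c ≤ fromℕ m * M + 1ℚ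
  pathSum-bound zero          c M 0≤M h₁ h₂ = ≤-by 0≤1 (eq M)
    where
    eq : ∀ M → 0ℚ * M + 1ℚ ≡ (1ℚ + 1ℚ) * 0ℚ + 1ℚ
    eq = solve-∀ ℚ-ring
  pathSum-bound (suc zero)    c M 0≤M h₁ h₂ = ≤-by (≤⇒0≤ (h₁ zero)) (eq (c zero) M)
    where
    eq : ∀ c M → (1ℚ + 0ℚ) * M + 1ℚ ≡ (1ℚ + 1ℚ) * (c + 0ℚ) + (M + 1ℚ - (1ℚ + 1ℚ) * c)
    eq = solve-∀ ℚ-ring
  pathSum-bound (suc (suc m)) c M 0≤M h₁ h₂ = ≤-by
    (0≤+ (0≤* (0≤+ 0≤1 0≤1) (≤⇒0≤ (h₂ zero (suc zero) refl)))
         (≤⇒0≤ (pathSum-bound m (λ i → c (suc (suc i))) M 0≤M (λ i → h₁ (suc (suc i)))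
           (λ i j e → h₂ (suc (suc i)) (suc (suc j)) (cong (λ t → suc (suc t)) e)))))
    (eq (c zero) (c (suc zero)) (sum (λ i → c (suc (suc i)))) (fromℕ m) M)
    where
    eq : ∀ a b s m M → (1ℚ + (1ℚ + m)) * M + 1ℚ ≡
         (1ℚ + 1ℚ) * (a + (b + s)) + ((1ℚ + 1ℚ) * (M - (a + b)) + (m * M + 1ℚ - (1ℚ + 1ℚ) * s))
    eq = solve-∀ ℚ-ring

  -- Each layer obeys the bound for k factors, and two adjacent layers share no second component, so
  -- together they have at most m ^ k elements. After pairing at most one layer is left over, so the
  -- error 1 does not accumulate.
  independent-bound : ∀ m k (χ : Fin (m ℕ.^ k) → Bool) →
    (∀ u v → χ u ≡ true → χ v ≡ true → ¬ Adj (Path m ^□ k) u v) →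
    2ℚ * sum ([_]ᵇ ∘ χ) ≤ fromℕ (m ℕ.^ k) + 1ℚ
  independent-bound m zero    χ ind with χ zero
  ... | true  = ℚₚ.≤-reflexive refl
  ... | false = ≤-by (0≤+ 0≤1 0≤1) refl
  independent-bound m (suc k) χ ind = subst₂ (λ a b → 2ℚ * a ≤ b + 1ℚ) (sym (∑-combine m ([_]ᵇ ∘ χ))) (sym (fromℕ-* m (m ℕ.^ k)))
    (pathSum-bound m (λ i → sum (λ x → [ χ (combine i x) ]ᵇ)) (fromℕ (m ℕ.^ k)) (0≤fromℕ (m ℕ.^ k)) layer layers)
    where
    H = Path m ^□ k
    Adj-combine : ∀ {i j : Fin m} {x x′} → (i ≡ j × Adj H x x′) ⊎ (x ≡ x′ × Adj (Path m) i j) →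
                  Adj (Path m ^□ suc k) (combine i x) (combine j x′)
    Adj-combine {i} {j} {x} {x′} = subst₂
      (λ α β → (proj₁ α ≡ proj₁ β × Adj H (proj₂ α) (proj₂ β)) ⊎ (proj₂ α ≡ proj₂ β × Adj (Path m) (proj₁ α) (proj₁ β)))
      (sym (Finₚ.remQuot-combine {m} i x)) (sym (Finₚ.remQuot-combine {m} j x′))
    layer : ∀ i → 2ℚ * sum (λ x → [ χ (combine i x) ]ᵇ) ≤ fromℕ (m ℕ.^ k) + 1ℚ
    layer i = independent-bound m k (λ x → χ (combine i x))
      λ x x′ e e′ xx′ → ind (combine i x) (combine i x′) e e′ (Adj-combine (inj₁ (refl , xx′)))
    layers : ∀ i j → toℕ j ≡ suc (toℕ i) → sum (λ x → [ χ (combine i x) ]ᵇ) + sum (λ x → [ χ (combine j x) ]ᵇ) ≤ fromℕ (m ℕ.^ k)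
    layers i j e = subst₂ _≤_ (∑-distrib-+ (λ x → [ χ (combine i x) ]ᵇ) (λ x → [ χ (combine j x) ]ᵇ))
      (trans (∑-const (m ℕ.^ k) 1ℚ) (ℚₚ.*-identityʳ (fromℕ (m ℕ.^ k))))
      (∑-mono λ x → not-both (χ (combine i x)) (χ (combine j x))
        λ e₁ e₂ → ind (combine i x) (combine j x) e₁ e₂ (Adj-combine (inj₂ (refl , inj₁ e))))
      where
      not-both : ∀ a b → (a ≡ true → b ≡ true → ⊥) → [ a ]ᵇ + [ b ]ᵇ ≤ 1ℚ
      not-both true  true  h = ⊥-elim (h refl refl)
      not-both true  false h = ℚₚ.≤-reflexive refl
      not-both false true  h = ℚₚ.≤-reflexive refl
      not-both false false h = 0≤1

  signᵇ-xor : ∀ a b → signᵇ (a xor b) ≡ signᵇ a * signᵇ b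
  signᵇ-xor true  b = trans (signᵇ-not b) (eq (signᵇ b))
    where
    eq : ∀ s → - s ≡ - 1ℚ * s
    eq = solve-∀ ℚ-ring
  signᵇ-xor false b = sym (ℚₚ.*-identityˡ (signᵇ b))

  -- `signᵇ` turns xor into multiplication, so the excess of false over true is multiplicative in
  -- the factors.
  ∑-signᵇ-product : ∀ m {n} (a : Fin m → Bool) (b : Fin n → Bool) →
    sum (λ u → signᵇ (a (proj₁ (remQuot {m} n u)) xor b (proj₂ (remQuot {m} n u)))) ≡ sum (signᵇ ∘ a) * sum (signᵇ ∘ b)
  ∑-signᵇ-product m {n} a b = begin
    sum (λ u → signᵇ (a (proj₁ (remQuot {m} n u)) xor b (proj₂ (remQuot {m} n u))))
      ≡⟨ ∑-combine m {n} (λ u → signᵇ (a (proj₁ (remQuot {m} n u)) xor b (proj₂ (remQuot {m} n u)))) ⟩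
    sum {m} (λ i → sum {n} (λ x → signᵇ (a (proj₁ (remQuot {m} n (combine i x))) xor b (proj₂ (remQuot {m} n (combine i x))))))
      ≡⟨ sum-cong-≗ (λ i → trans (sum-cong-≗ (λ x → trans
           (cong (λ α → signᵇ (a (proj₁ α) xor b (proj₂ α))) (Finₚ.remQuot-combine {m} i x)) (signᵇ-xor (a i) (b x))))
           (∑-*ˡ (signᵇ (a i)) (signᵇ ∘ b))) ⟩
    sum (λ i → signᵇ (a i) * sum (signᵇ ∘ b))
      ≡⟨ *-distribʳ-sum (sum (signᵇ ∘ b)) (signᵇ ∘ a) ⟨
    sum (signᵇ ∘ a) * sum (signᵇ ∘ b) ∎
    where open ≡-Reasoning

  ∑-sign : ∀ n → sum (sign {suc (n ℕ.* 2)}) ≡ 1ℚ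
  ∑-sign zero    = refl
  ∑-sign (suc n) = begin
    1ℚ + (- 1ℚ + sum (λ i → signᵇ (not (not (odd (toℕ {suc (n ℕ.* 2)} i))))))
      ≡⟨ cong (λ t → 1ℚ + (- 1ℚ + t)) (trans (sum-cong-≗ {suc (n ℕ.* 2)} (λ i → cong signᵇ (not-not (odd (toℕ i))))) (∑-sign n)) ⟩
    1ℚ ∎
    where
    open ≡-Reasoning
    not-not : ∀ b → not (not b) ≡ b
    not-not true  = refl
    not-not false = refl

  ∑-colour : ∀ m → sum (sign {m}) ≡ 1ℚ → ∀ k → sum (signᵇ ∘ colour m k) ≡ 1ℚ
  ∑-colour m e zero    = refl
  ∑-colour m e (suc k) = trans (∑-signᵇ-product m (λ i → odd (toℕ i)) (colour m k)) (cong₂ _*_ e (∑-colour m e k))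

  -- A 2-colouring b of a path with three more vertices of one colour is spread
  -- over the product by flipping it along the proper colouring of the other
  -- factors, so that only the edges in the first direction are monochromatic.
  module _ (m : ℕ) (∑sign : sum (sign {m}) ≡ 1ℚ)
           (b : Fin m → Bool) (∑b : sum (signᵇ ∘ b) ≡ fromℕ 3)
           (d : ℕ) (b-degree : ∀ i → sum (λ j → [ not (b i xor b j) ∧ does (adj? (Path m) i j) ]ᵇ) ≤ fromℕ d) where

    f≤d : ∀ k → f (Path m ^□ suc k) ℕ.≤ d
    f≤d k = f≤ G S (α< G independent<) degree≤d
      where
      G = Path m ^□ suc k
      H = Path m ^□ k
      N = m ℕ.^ suc k
      split : Fin N → Fin m × Fin (m ℕ.^ k)
      split = remQuot {m} (m ℕ.^ k)
      χ : Fin m × Fin (m ℕ.^ k) → Bool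
      χ (i , x) = b i xor colour m k x
      S : Subset N
      S = tabulate (not ∘ χ ∘ split)

      ∣S∣ : 2ℚ * fromℕ Subset.∣ S ∣ ≡ fromℕ N + fromℕ 3
      ∣S∣ = begin
        2ℚ * fromℕ Subset.∣ S ∣                                        ≡⟨ cong (2ℚ *_) (∣tabulate∣≡∑ (not ∘ χ ∘ split)) ⟩
        2ℚ * sum (λ u → [ not (χ (split u)) ]ᵇ)                        ≡⟨ ∑-*ˡ 2ℚ (λ u → [ not (χ (split u)) ]ᵇ) ⟨
        sum (λ u → 2ℚ * [ not (χ (split u)) ]ᵇ)                        ≡⟨ sum-cong-≗ (λ u → double (χ (split u))) ⟩
        sum (λ u → 1ℚ + signᵇ (χ (split u)))                           ≡⟨ ∑-distrib-+ (λ _ → 1ℚ) (λ u → signᵇ (χ (split u))) ⟩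
        sum {N} (λ _ → 1ℚ) + sum (λ u → signᵇ (χ (split u)))           ≡⟨ cong₂ _+_ (trans (∑-const N 1ℚ) (ℚₚ.*-identityʳ (fromℕ N)))
                                                                            (trans (∑-signᵇ-product m b (colour m k)) (cong₂ _*_ ∑b (∑-colour m ∑sign k))) ⟩
        fromℕ N + fromℕ 3 * 1ℚ                                         ≡⟨ cong (fromℕ N +_) (ℚₚ.*-identityʳ (fromℕ 3)) ⟩
        fromℕ N + fromℕ 3                                              ∎
        where
        open ≡-Reasoning
        double : ∀ c → 2ℚ * [ not c ]ᵇ ≡ 1ℚ + signᵇ c
        double true  = refl
        double false = refl

      independent< : ∀ I → Independent G I → Subset.∣ I ∣ ℕ.< Subset.∣ S ∣
      independent< I ind = fromℕ-cancel-≤ (ℚₚ.*-cancelˡ-≤-pos 2ℚ (begin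
        2ℚ * (1ℚ + fromℕ Subset.∣ I ∣)               ≡⟨ eq (fromℕ Subset.∣ I ∣) ⟩
        2ℚ * fromℕ Subset.∣ I ∣ + 2ℚ                 ≡⟨ cong (λ t → 2ℚ * t + 2ℚ) (∣p∣≡∑ I) ⟩
        2ℚ * sum ([_]ᵇ ∘ lookup I) + 2ℚ              ≤⟨ ℚₚ.+-monoˡ-≤ 2ℚ (independent-bound m (suc k) (lookup I)
                                                         (λ u v e e′ → ind u v (lookup⇒∈ e) (lookup⇒∈ e′))) ⟩
        fromℕ N + 1ℚ + 2ℚ                            ≡⟨ ℚₚ.+-assoc (fromℕ N) 1ℚ 2ℚ ⟩
        fromℕ N + fromℕ 3                            ≡⟨ ∣S∣ ⟨
        2ℚ * fromℕ Subset.∣ S ∣                      ∎))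
        where
        open ℚₚ.≤-Reasoning
        eq : ∀ i → (1ℚ + 1ℚ) * (1ℚ + i) ≡ (1ℚ + 1ℚ) * i + (1ℚ + 1ℚ)
        eq = solve-∀ ℚ-ring

      degree≤d : ∀ u → u ∈ S → Subset.∣ S ∩ neighbours G u ∣ ℕ.≤ d
      degree≤d u u∈S = fromℕ-cancel-≤ (begin
        fromℕ Subset.∣ S ∩ neighbours G u ∣                               ≡⟨ ∣p∣≡∑ (S ∩ neighbours G u) ⟩
        sum (λ v → [ lookup (S ∩ neighbours G u) v ]ᵇ)                    ≤⟨ ∑-mono pointwise ⟩
        sum (λ v → bound (split v))                                       ≡⟨ ∑-combine m {m ℕ.^ k} (λ v → bound (split v)) ⟩
        sum {m} (λ j → sum {m ℕ.^ k} (λ x → bound (split (combine j x))))               ≡⟨ sum-cong-≗ (λ j → trans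
                                                                               (sum-cong-≗ (λ x → cong bound (Finₚ.remQuot-combine {m} j x)))
                                                                               (∑-δ (proj₂ (split u)) (λ _ → same j))) ⟩
        sum same                                                          ≤⟨ b-degree (proj₁ (split u)) ⟩
        fromℕ d                                                           ∎)
        where
        open ℚₚ.≤-Reasoning
        same : Fin m → ℚ
        same j = [ not (b (proj₁ (split u)) xor b j) ∧ does (adj? (Path m) (proj₁ (split u)) j) ]ᵇ
        -- A neighbour of u in a later direction has the other colour and is not in S. The factor δ
        -- therefore confines the sum to the line through u in the first direction.
        bound : Fin m × Fin (m ℕ.^ k) → ℚ
        bound (j , x) = δ (proj₂ (split u)) x * same j
        0≤bound : ∀ β → 0ℚ ≤ bound β
        0≤bound (j , x) = 0≤* (0≤[]ᵇ (does (proj₂ (split u) Finₚ.≟ x)))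
          (0≤[]ᵇ (not (b (proj₁ (split u)) xor b j) ∧ does (adj? (Path m) (proj₁ (split u)) j)))
        xor-cancel : ∀ c c′ e → not (c xor e) ≡ true → not (c′ xor e) ≡ true → not (c xor c′) ≡ true
        xor-cancel true  true  true  _ _ = refl
        xor-cancel false false false _ _ = refl
        xor-cancel true  true  false () _
        xor-cancel true  false true  _ ()
        xor-cancel true  false false () _
        xor-cancel false true  true  () _
        xor-cancel false true  false _ ()
        xor-cancel false false true  () _
        xor-flip : ∀ c e → not (c xor e) ≡ true → not (c xor not e) ≡ true → ⊥
        xor-flip true  true  _ ()
        xor-flip true  false () _
        xor-flip false true  () _
        xor-flip false false _ ()
        step : ∀ α β → not (χ α) ≡ true → not (χ β) ≡ true →
               (proj₁ α ≡ proj₁ β × Adj H (proj₂ α) (proj₂ β)) ⊎ (proj₂ α ≡ proj₂ β × Adj (Path m) (proj₁ α) (proj₁ β)) →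
               1ℚ ≤ δ (proj₂ α) (proj₂ β) * [ not (b (proj₁ α) xor b (proj₁ β)) ∧ does (adj? (Path m) (proj₁ α) (proj₁ β)) ]ᵇ
        step (i , x) (j , x′) e e′ (inj₁ (refl , xx′)) = ⊥-elim (xor-flip (b i) (colour m k x) e
          (subst (λ c → not (b i xor c) ≡ true) (colour-proper m k xx′) e′))
        step (i , x) (j , x′) e e′ (inj₂ (refl , ij)) = ℚₚ.≤-reflexive (sym (cong₂ _*_ (δ-refl x)
          (cong [_]ᵇ (cong₂ _∧_ (xor-cancel (b i) (b j) (colour m k x) e e′) (does-true (adj? (Path m) i j) ij)))))
        pointwise : ∀ v → [ lookup (S ∩ neighbours G u) v ]ᵇ ≤ bound (split v)
        pointwise v = []ᵇ≤ (0≤bound (split v)) λ e →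
          let v∈S , v∈N = Subsetₚ.x∈p∩q⁻ S (neighbours G u) (lookup⇒∈ e)
          in step (split u) (split v) (∈-tabulate⁻ {b = not ∘ χ ∘ split} u∈S) (∈-tabulate⁻ {b = not ∘ χ ∘ split} v∈S)
               (does-true⁻ (adj? G u v) (∈-tabulate⁻ {b = λ v → does (adj? G u v)} v∈N))

  -- On three vertices an excess of 3 forces the constant colouring, so the bound is the maximum
  -- degree of the path itself.
  f[P₃^k]≤2 : ∀ k → f (Path 3 ^□ suc k) ℕ.≤ 2
  f[P₃^k]≤2 = f≤d 3 (∑-sign 1) (λ _ → false) refl 2 λ
    { zero             → ≤-by 0≤1 (end 1ℚ)
    ; (suc zero)       → ≤-by ℚₚ.≤-refl (middle 1ℚ)
    ; (suc (suc zero)) → ≤-by 0≤1 (end 1ℚ) }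
    where
    end : ∀ x → x + (x + 0ℚ) ≡ 0ℚ + (x + (0ℚ + 0ℚ)) + x
    end = solve-∀ ℚ-ring
    middle : ∀ x → x + (x + 0ℚ) ≡ x + (0ℚ + (x + 0ℚ)) + 0ℚ
    middle = solve-∀ ℚ-ring

  ∑≤1 : ∀ {n} (χ : Fin n → Bool) t → (∀ j → χ j ≡ true → toℕ j ≡ t) → sum ([_]ᵇ ∘ χ) ≤ 1ℚ
  ∑≤1 {zero}  χ t h = 0≤1
  ∑≤1 {suc n} χ zero h = ≤-by (≤⇒0≤ ([]ᵇ≤ {χ zero} 0≤1 λ _ → ℚₚ.≤-refl)) (trans (eq [ χ zero ]ᵇ)
    (cong (λ s → [ χ zero ]ᵇ + s + (1ℚ - [ χ zero ]ᵇ)) (sym (∑-0 λ j → none (χ (suc j)) λ e → case h (suc j) e of λ ()))))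
    where
    none : ∀ b → (b ≡ true → ⊥) → [ b ]ᵇ ≡ 0ℚ
    none true  h = ⊥-elim (h refl)
    none false h = refl
    eq : ∀ a → 1ℚ ≡ a + 0ℚ + (1ℚ - a)
    eq = solve-∀ ℚ-ring
  ∑≤1 {suc n} χ (suc t) h with χ zero in e
  ... | true  = case h zero e of λ ()
  ... | false = subst (_≤ 1ℚ) (sym (ℚₚ.+-identityˡ (sum ([_]ᵇ ∘ χ ∘ suc)))) (∑≤1 (χ ∘ suc) t λ j e′ → ℕₚ.suc-injective (h (suc j) e′))

  -- The vertices 0, 1, 3, 4, 6, 8, … get the colour false, so the monochromatic
  -- edges are {0, 1} and {3, 4}.
  two-edges : ℕ → Bool
  two-edges 2                         = true
  two-edges (suc (suc (suc (suc j)))) = odd j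
  two-edges _                         = false

  -- The default 0 is arbitrary: vertices other than 0, 1, 3, 4 have no neighbour of their own
  -- colour.
  partner : ℕ → ℕ
  partner 0 = 1
  partner 1 = 0
  partner 3 = 4
  partner 4 = 3
  partner _ = 0

  two-edges-matching : ∀ i → two-edges i ≡ two-edges (suc i) → partner i ≡ suc i × partner (suc i) ≡ i
  two-edges-matching 0 _ = refl , refl
  two-edges-matching 1 ()
  two-edges-matching 2 ()
  two-edges-matching 3 _ = refl , refl
  two-edges-matching (suc (suc (suc (suc j)))) e = contradiction e b≢not-b

  -- Vertices 0 to 3 contribute 1 + 1 - 1 + 1. From vertex 4 on, an odd number of vertices
  -- alternates beginning with false and contributes 1.
  ∑-two-edges : ∀ n {m} → m ≡ suc (suc (suc n) ℕ.* 2) → sum (λ (i : Fin m) → signᵇ (two-edges (toℕ i))) ≡ fromℕ 3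
  ∑-two-edges n refl = trans (cong (λ t → 1ℚ + (1ℚ + (- 1ℚ + (1ℚ + t)))) (∑-sign n)) (eq 1ℚ)
    where
    eq : ∀ x → x + (x + (- x + (x + x))) ≡ x + (x + (x + 0ℚ))
    eq = solve-∀ ℚ-ring

  two-edges-degree : ∀ {m} (i : Fin m) →
    sum (λ j → [ not (two-edges (toℕ i) xor two-edges (toℕ j)) ∧ does (adj? (Path m) i j) ]ᵇ) ≤ fromℕ 1
  two-edges-degree {m} i = subst (sum ([_]ᵇ ∘ χ) ≤_) (sym (ℚₚ.+-identityʳ 1ℚ)) (∑≤1 χ (partner (toℕ i)) λ j e →
    let same , adj = ∧-true⁻ {not (b i xor b j)} e
    in matched (toℕ i) (toℕ j) (xor-same (b i) (b j) same) (does-true⁻ (adj? (Path m) i j) adj))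
    where
    b : Fin m → Bool
    b j = two-edges (toℕ j)
    χ : Fin m → Bool
    χ j = not (b i xor b j) ∧ does (adj? (Path m) i j)
    xor-same : ∀ a b → not (a xor b) ≡ true → a ≡ b
    xor-same true  true  _ = refl
    xor-same false false _ = refl
    matched : ∀ i j → two-edges i ≡ two-edges j → j ≡ suc i ⊎ i ≡ suc j → j ≡ partner i
    matched i j e (inj₁ refl) = sym (proj₁ (two-edges-matching i e))
    matched i j e (inj₂ refl) = sym (proj₂ (two-edges-matching j (sym e)))

  f[Pₘ^k]≤1 : ∀ n {m} → m ≡ suc (suc (suc n) ℕ.* 2) → ∀ k → f (Path m ^□ suc k) ℕ.≤ 1
  f[Pₘ^k]≤1 n {m} m≡ = f≤d m (subst (λ m → sum (sign {m}) ≡ 1ℚ) (sym m≡) (∑-sign (suc (suc n))))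
    (λ i → two-edges (toℕ i)) (∑-two-edges n m≡) 1 two-edges-degree

  -- The values of f, and the passage to real square roots

  1≤f : ∀ {n} (G : Graph n) → 1 ℕ.≤ n → 1 ℕ.≤ f G
  1≤f G 1≤n = f-elim G (1 ℕ.≤_) 1≤n (Δ[]≥1 G)

  f[P₃^k]≡2 : ∀ k → 1 ℕ.≤ k → f (Path 3 ^□ k) ≡ 2
  f[P₃^k]≡2 (suc k) 1≤k = ℕₚ.≤-antisym (f[P₃^k]≤2 k) (f[P₃^k]≥2 (suc k) 1≤k)

  f[Pₘ^k]≡1 : ∀ k → 1 ℕ.≤ k → ∀ n → 5 ℕ.≤ 2 ℕ.* n ℕ.+ 1 → f (Path (2 ℕ.* n ℕ.+ 1) ^□ k) ≡ 1
  f[Pₘ^k]≡1 k       _ zero       (s≤s ())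
  f[Pₘ^k]≡1 k       _ (suc zero) (s≤s (s≤s (s≤s ())))
  f[Pₘ^k]≡1 (suc k) _ (suc (suc n)) 5≤m = ℕₚ.≤-antisym (f[Pₘ^k]≤1 n m≡ k)
    (1≤f (Path (2 ℕ.* suc (suc n) ℕ.+ 1) ^□ suc k) (ℕₚ.≤-trans (s≤s z≤n) (n<m^n (ℕₚ.≤-trans (s≤s (s≤s z≤n)) 5≤m) (suc k))))
    where
    m≡ : 2 ℕ.* suc (suc n) ℕ.+ 1 ≡ suc (suc (suc n) ℕ.* 2)
    m≡ = trans (ℕₚ.+-comm (2 ℕ.* suc (suc n)) 1) (cong suc (ℕₚ.*-comm 2 (suc (suc n))))

  -- Minimality of the ceiling reduces the claim to r ≤ F. If r stayed above F + ε, then r² would be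
  -- at least F² + ε² at every late index. But there r² is within less than ε² of k times a left end
  -- of the bisection, and each such product is at most F².
  √βk≤f : ∀ k n → 2 ℕ.≤ 2 ℕ.* n → ∀ r c → IsSqrt (β n *ᴿ fromℤ (ℤ.+ k)) r → IsCeiling r c →
          c ℤ.≤ ℤ.+ f (Path (2 ℕ.* n) ^□ k)
  √βk≤f k n 2≤2n r c (_ , r²≃βk) (_ , least) = least (ℤ.+ F) λ (ε , 0<ε , N , F+ε<r) →
    let M , close = r²≃βk (ε * ε) (0<* 0<ε 0<ε)
        i = N ℕ.⊔ M
    in contradiction-at ε 0<ε (F+ε<r i (ℕₚ.m≤m⊔n N M)) (close i (ℕₚ.m≤n⊔m N M))
    where
    F = f (Path (2 ℕ.* n) ^□ k)
    bound : ∀ i → fromℕ k * bisect n i ≤ fromℕ F * fromℕ F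
    bound i = subst (λ m → fromℕ k * bisect n i ≤ fromℕ (f (Path m ^□ k)) * fromℕ (f (Path m ^□ k))) (ℕₚ.*-comm n 2)
      (f²≥ n (ℕₚ.*-cancelˡ-≤ 2 2≤2n) (bisect-below n i) k)
    contradiction-at : ∀ ε → 0ℚ < ε → ∀ {i} → (ℤ.+ F) ℚ./ 1 + ε < seq r i →
      ℚ.∣ seq r i * seq r i - bisect n i * ((ℤ.+ k) ℚ./ 1) ∣ < ε * ε → ⊥
    contradiction-at ε 0<ε {i} F+ε<r close = ℚₚ.<-irrefl refl (begin-strict
      x * x                                         ≡⟨ eq₁ (x * x) (a * K) ⟩
      a * K + (x * x - a * K)                       <⟨ ℚₚ.+-monoʳ-< (a * K) (ℚₚ.≤-<-trans (p≤∣p∣ (x * x - a * K)) close) ⟩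
      a * K + ε * ε                                 ≡⟨ cong (_+ ε * ε) (trans (ℚₚ.*-comm a K) (cong (_* a) (sym (fromℕ≡/1 k)))) ⟩
      fromℕ k * a + ε * ε                           ≤⟨ ℚₚ.+-monoˡ-≤ (ε * ε) (bound i) ⟩
      fromℕ F * fromℕ F + ε * ε                     ≤⟨ ≤-by (0≤+ (0≤* 0≤2F (ℚₚ.<⇒≤ 0<ε)) (0≤* 0≤e (0≤+ 0≤e (0≤+ 0≤F+ε 0≤F+ε)))) (eq₂ x (fromℕ F) ε) ⟩
      x * x                                         ∎)
      where
      open ℚₚ.≤-Reasoning
      x = seq r i
      a = bisect n i
      K = (ℤ.+ k) ℚ./ 1
      0≤2F : 0ℚ ≤ 2ℚ * fromℕ F
      0≤2F = 0≤* (0≤+ 0≤1 0≤1) (0≤fromℕ F)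
      0≤F+ε : 0ℚ ≤ fromℕ F + ε
      0≤F+ε = 0≤+ (0≤fromℕ F) (ℚₚ.<⇒≤ 0<ε)
      0≤e : 0ℚ ≤ x - (fromℕ F + ε)
      0≤e = ≤⇒0≤ (ℚₚ.<⇒≤ (subst (λ t → t + ε < x) (sym (fromℕ≡/1 F)) F+ε<r))
      eq₁ : ∀ a b → a ≡ b + (a - b)
      eq₁ = solve-∀ ℚ-ring
      eq₂ : ∀ x F ε → x * x ≡ F * F + ε * ε + ((1ℚ + 1ℚ) * F * ε + (x - (F + ε)) * (x - (F + ε) + (F + ε + (F + ε))))
      eq₂ = solve-∀ ℚ-ring

open import Data.Nat using (ℕ; _+_; _*_; _≤_)
open import Data.Integer using (+_) renaming (_≤_ to _≤ᶻ_)
open import Data.Product using (Σ-syntax; _×_)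
open import Relation.Binary.PropositionalEquality using (_≡_)

theorem1p2 : Σ[ β ∈ (ℕ → ℝ) ]
    (∀ n → 1 ≤ n → IsMinPositiveRoot (g n) (β n)) ×
    (∀ k → 1 ≤ k →
    (f (Path 3 ^□ k) ≡ 2) ×
    (∀ n → 5 ≤ 2 * n + 1 → f (Path (2 * n + 1) ^□ k) ≡ 1) ×
    (∀ n → 2 ≤ 2 * n → ∀ r c → IsSqrt (β n *ᴿ fromℤ (+ k)) r → IsCeiling r c → c ≤ᶻ + f (Path (2 * n) ^□ k))) ×
    (β 1 ≃ 1ᴿ)
theorem1p2 = β , β-minPositiveRoot , (λ k 1≤k → f[P₃^k]≡2 k 1≤k , f[Pₘ^k]≡1 k 1≤k , √βk≤f k) , β₁≃1
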